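{- For all positive integers $a,r,s$ with $s\geq r+1$ and all integers $n\geq 2r(s+2)+ r(s+2)\sqrt{s-1}$, \[\mathrm{ex}_{\Pi}\left(n, s, \Sigma_{r,0}(a,s)\right) = \Pi_{r,0}(a,n).\] Furthermore, the set of multigraphs $G\in\mathcal{F}(n,s,\Sigma_{r,0}(a,s))$ with $P(G)=\mathrm{ex}_{\Pi}(n,s,\Sigma_{r,0}(a,s))$ is precisely the family $T^P_{r,0}(a,n)$.
   Context: A multigraph is a pair $G=(V,w)$ where $V$ is a finite set and $w:\binom{V}{2}\to\mathbb{Z}_{\geq 0}$. For $X\subseteq V$ write $e(G[X])=\sum_{xy\in\binom{X}{2}}w(xy)$, $e(G)=e(G[V])$ and $P(G)=\prod_{xy\in\binom{V}{2}}w(xy)$. Given integers $s\geq 2$, $q\geq 0$, $\mathcal{F}(n,s,q)$ denotes the set of multigraphs on vertex set $[n]=\{1,\dots,n\}$ in which every $s$-set $X$ of vertices satisfies $e(G[X])\leq q$, and $\mathrm{ex}_{\Pi}(n,s,q)=\max\{P(G): G\in\mathcal{F}(n,s,q)\}$. For positive integers $a,r$, $d\in\{0,\dots,a-1\}$ and $n$, $\mathcal{T}_{r,d}(a,n)$ is the set of multigraphs $G$ on $[n]$ whose vertex set can be partitioned into $r$ parts $V_0,\dots,V_{r-1}$ such that all pairs inside $V_0$ have multiplicity $a-d$, all pairs inside $V_i$ ($1\le i\le r-1$) have multiplicity $a$, and all other pairs have multiplicity $a+1$. $\Sigma_{r,d}(a,n)=\max\{e(G):G\in\mathcal{T}_{r,d}(a,n)\}$,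 $\Pi_{r,d}(a,n)=\max\{P(G):G\in\mathcal{T}_{r,d}(a,n)\}$, and $T^P_{r,d}(a,n)$ is the set of $G\in\mathcal{T}_{r,d}(a,n)$ with $P(G)=\Pi_{r,d}(a,n)$. -}

module Defs where

open import Data.Nat using (ℕ; zero; suc; _+_; _*_; _∸_; _≤_)
open import Data.Bool using (Bool; true; false; if_then_else_; _∧_)
open import Data.Fin using (Fin; toℕ; _<?_)
import Data.Fin as F
open import Data.Fin.Subset using (Subset; ∣_∣)
open import Data.Vec using (lookup)
open import Data.List using (List; map; filter; cartesianProduct; allFin)
open import Data.Nat.ListAction using (sum; product)
open import Data.Product using (_×_; _,_; proj₁; proj₂; Σ; ∃)
open import Relation.Nullary using (does)
open import Relation.Binary.PropositionalEquality using (_≡_)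
import Data.Nat as N

-- A multigraph on [n] = Fin n.  Only the values  w i j  with  i < j  are
-- ever read: they encode the multiplicity of the unordered pair {i,j}.
Multigraph : ℕ → Set
Multigraph n = Fin n → Fin n → ℕ

pairs : (n : ℕ) → List (Fin n × Fin n)
pairs n = filter (λ p → proj₁ p <? proj₂ p) (cartesianProduct (allFin n) (allFin n))

edges : {n : ℕ} → Multigraph n → ℕ
edges {n} w = sum (map (λ p → w (proj₁ p) (proj₂ p)) (pairs n))

edgesIn : {n : ℕ} → Multigraph n → Subset n → ℕ
edgesIn {n} w X =
  sum (map (λ p → if lookup X (proj₁ p) ∧ lookup X (proj₂ p)
                  then w (proj₁ p) (proj₂ p) else 0) (pairs n))

prodW : {n : ℕ} → Multigraph n → ℕ
prodW {n} w = product (map (λ p → w (proj₁ p) (proj₂ p)) (pairs n))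

InF : (n s q : ℕ) → Multigraph n → Set
InF n s q w = (X : Subset n) → ∣ X ∣ ≡ s → edgesIn w X ≤ q

-- multiplicity of a pair whose endpoints lie in parts x, y (part 0 is V_0)
partMult : {r : ℕ} → (d a : ℕ) → Fin r → Fin r → ℕ
partMult d a x y =
  if does (x F.≟ y)
  then (if does (toℕ x N.≟ 0) then a ∸ d else a)
  else suc a

-- G ∈ T_{r,d}(a,n): a partition V_0,...,V_{r-1} (given by f : [n] → Fin r,
-- parts possibly empty) realising the prescribed multiplicities.
InT : (r d a n : ℕ) → Multigraph n → Set
InT r d a n w =
  Σ (Fin n → Fin r) λ f →
    (i j : Fin n) → toℕ i N.< toℕ j → w i j ≡ partMult d a (f i) (f j)

IsMax : {k : ℕ} → (Multigraph k → Set) → (Multigraph k → ℕ) → ℕ → Set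
IsMax {k} Pred val m =
  (∃ λ (w : Multigraph k) → Pred w × val w ≡ m) ×
  ((w : Multigraph k) → Pred w → val w ≤ m)

{-# OPTIONS --safe #-}
module Submission where

-- Let t_r(m) be the number of edges of the r-partite Turán graph on m vertices.  Averaging over deleted
-- vertices and rounding down, the bound a C(m,2) + t_r(m) on the edges of m-sets passes to (m+1)-sets
-- whenever m > r.  Hence e(G) ≤ a C(n,2) + t_r(n), and by the integral AM-GM inequality P(G) is at most the
-- product of the Turán multigraph, with equality only if all multiplicities are a or a + 1 and e(G) is
-- extremal.  In the equality case let H be the graph of pairs of multiplicity a + 1.  Its minimum degree is
-- that of the Turán graph, so a set of m < s vertices spanning more than t_r(m) edges of H could be enlarged
-- one vertex at a time until it violates the hypothesis on s-sets.  So H has no (r+1)-clique, and Zykov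
-- symmetrisation shows that non-adjacency is an equivalence relation, with at most r classes.

open import Defs
open import Data.Bool using (Bool; true; false; if_then_else_; _∧_)
open import Data.Fin using (Fin; zero; suc; toℕ; punchIn)
import Data.Fin as F
import Data.Fin.Properties as F
open import Data.Fin.Subset using (Subset; ∣_∣)
open import Data.List using (List; []; _∷_; _++_; map; filter; length; cartesianProduct; allFin; tabulate)
open import Data.List.Membership.Propositional.Properties using (∈-filter⁺; ∈-cartesianProduct⁺; ∈-allFin)
open import Data.List.Properties using (map-tabulate; map-++; map-∘; length-map)
open import Data.List.Relation.Unary.All as All using (All; []; _∷_)
import Data.List.Relation.Unary.All.Properties as All
open import Data.Nat using (ℕ; zero; suc; _+_; _*_; _∸_; _^_; _/_; _%_; _≤_; _<_; _≤?_; z≤n; s≤s; s≤s⁻¹; NonZero; >-nonZero)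
open import Data.Nat.DivMod using (m≡m%n+[m/n]*n; m%n<n; m*n/n≡m; m/n*n≤m; m<n⇒m/n≡0; m≥n⇒m/n>0; n/n≡1; +-distrib-/-∣ʳ)
open import Data.Nat.Divisibility using (n∣m*n)
open import Data.Nat.ListAction using (sum; product)
open import Data.Nat.ListAction.Properties using (sum-++)
open import Data.Nat.Properties
open import Data.Nat.Tactic.RingSolver using (solve-∀)
open import Data.Product using (_×_; _,_; proj₁; proj₂; Σ; ∃; ∃₂)
open import Data.Sum using (_⊎_; inj₁; inj₂)
open import Data.Vec using (lookup)
import Data.Vec as Vec
open import Data.Vec.Functional using () renaming (_∷_ to _◂_)
open import Data.Vec.Properties using (lookup∘tabulate)
open import Function using (_∘_; _on_; id)
open import Function.Definitions using (Injective)
open import Relation.Binary using (tri<; tri≈; tri>)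
open import Relation.Binary.PropositionalEquality using (_≡_; _≢_; refl; sym; trans; cong; cong₂; subst; subst₂; module ≡-Reasoning)
open import Relation.Nullary using (¬_; Dec; yes; no; does; contradiction)
open import Relation.Nullary.Decidable using (dec-true; dec-false)
open import Relation.Unary using (Decidable)
open import Algebra.Properties.Semiring.Sum +-*-semiring using (sum-cong-≗; sum-remove; ∑-distrib-+; ∑-comm; *-distribˡ-sum; *-distribʳ-sum) renaming (sum to ∑)

-- To stay inside the natural numbers, edge counts are doubled and subtracted terms are moved to the
-- other side; parity then turns a strict inequality into a gap of 2, which is the rounding. For m >
-- r the averaged bound lies less than 1 above the target. At m = r it lies exactly 1 above, since
-- t_r(r+1) is one short of complete. The number q is given only as a maximum, so its size has to
-- come from Turán's theorem. That theorem is the same averaging with a = 0, started at r + 1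
-- points. The enlargement of an overfull m-set rests on r(floor(m/r) + 1) > m: if no enlargement
-- stayed overfull, each outside vertex would miss at least floor(m/r) + 1 of the m vertices, while
-- the degree condition lets each of these miss only about n/r vertices. The two counts conflict
-- once n is at least rm + m + 2.

-- Finite sums and counting along tuples.

∑-mono-≤ : ∀ {n} {f g : Fin n → ℕ} → (∀ i → f i ≤ g i) → ∑ f ≤ ∑ g
∑-mono-≤ {zero}  p = z≤n
∑-mono-≤ {suc n} p = +-mono-≤ (p zero) (∑-mono-≤ (p ∘ suc))

∑-const : ∀ n c → ∑ {n} (λ _ → c) ≡ n * c
∑-const zero    c = refl
∑-const (suc n) c = cong (c +_) (∑-const n c)

Inj : ∀ {m n} → (Fin m → Fin n) → Set
Inj = Injective _≡_ _≡_

δ : ∀ {n} → Fin n → Fin n → ℕ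
δ i j = if does (i F.≟ j) then 1 else 0

δ-refl : ∀ {n} (i : Fin n) → δ i i ≡ 1
δ-refl i rewrite dec-true (i F.≟ i) refl = refl

δ-≢ : ∀ {n} {i j : Fin n} → i ≢ j → δ i j ≡ 0
δ-≢ {i = i} {j} i≢j rewrite dec-false (i F.≟ j) i≢j = refl

∑-zero : ∀ {n} {f : Fin n → ℕ} → (∀ i → f i ≡ 0) → ∑ f ≡ 0
∑-zero {n} f≡0 = trans (sum-cong-≗ f≡0) (trans (∑-const n 0) (*-zeroʳ n))

∑-δ : ∀ {n} (i : Fin n) (g : Fin n → ℕ) → ∑ (λ j → δ i j * g j) ≡ g i
∑-δ {suc n} i g = begin
  ∑ (λ j → δ i j * g j)
    ≡⟨ sum-remove {i = i} (λ j → δ i j * g j) ⟩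
  δ i i * g i + ∑ (λ j → δ i (punchIn i j) * g (punchIn i j))
    ≡⟨ cong₂ _+_ (cong (_* g i) (δ-refl i))
         (∑-zero λ j → cong (_* g (punchIn i j)) (δ-≢ (F.punchInᵢ≢i i j ∘ sym))) ⟩
  1 * g i + 0
    ≡⟨ trans (+-identityʳ _) (*-identityˡ _) ⟩
  g i ∎
  where open ≡-Reasoning

-- For injective `c` this is the indicator function of the image.
fibre : ∀ {m n} → (Fin m → Fin n) → Fin n → ℕ
fibre c v = ∑ (λ k → δ (c k) v)

∑-fibre : ∀ {m n} (c : Fin m → Fin n) (g : Fin n → ℕ) → ∑ (λ v → fibre c v * g v) ≡ ∑ (g ∘ c)
∑-fibre c g = begin
  ∑ (λ v → fibre c v * g v)              ≡⟨ sum-cong-≗ (λ v → *-distribʳ-sum (g v) (λ k → δ (c k) v)) ⟩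
  ∑ (λ v → ∑ (λ k → δ (c k) v * g v))    ≡⟨ ∑-comm (λ v k → δ (c k) v * g v) ⟩
  ∑ (λ k → ∑ (λ v → δ (c k) v * g v))    ≡⟨ sum-cong-≗ (λ k → ∑-δ (c k) g) ⟩
  ∑ (g ∘ c) ∎
  where open ≡-Reasoning

∑-fibre-1 : ∀ {m n} (c : Fin m → Fin n) → ∑ (fibre c) ≡ m
∑-fibre-1 {m} c = begin
  ∑ (fibre c)              ≡⟨ sum-cong-≗ (λ v → sym (*-identityʳ (fibre c v))) ⟩
  ∑ (λ v → fibre c v * 1)  ≡⟨ ∑-fibre c (λ _ → 1) ⟩
  ∑ {m} (λ _ → 1)          ≡⟨ ∑-const m 1 ⟩
  m * 1                    ≡⟨ *-identityʳ m ⟩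
  m ∎
  where open ≡-Reasoning

fibre-∈ : ∀ {m n} {c : Fin m → Fin n} → Inj c → ∀ k → fibre c (c k) ≡ 1
fibre-∈ {c = c} c-inj k = begin
  ∑ (λ l → δ (c l) (c k))  ≡⟨ sum-cong-≗ eq ⟩
  ∑ (λ l → δ k l * 1)      ≡⟨ ∑-δ k (λ _ → 1) ⟩
  1 ∎
  where
  open ≡-Reasoning
  eq : ∀ l → δ (c l) (c k) ≡ δ k l * 1
  eq l with k F.≟ l
  ... | yes refl = δ-refl (c k)
  ... | no k≢l   = δ-≢ (k≢l ∘ sym ∘ c-inj)

fibre-∉ : ∀ {m n} {c : Fin m → Fin n} {v} → (∀ k → c k ≢ v) → fibre c v ≡ 0
fibre-∉ v∉c = ∑-zero (λ k → δ-≢ (v∉c k))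

-- The sum over the `n - m` points outside the tuple is at most `(n - m) * B`, written without
-- subtraction. Pointwise, both sides agree on the image, and off it the claim is the hypothesis.
∑-outside-≤ : ∀ {m n} {c : Fin m → Fin n} → Inj c → (g : Fin n → ℕ) (B : ℕ) →
              (∀ v → (∀ k → c k ≢ v) → g v ≤ B) → ∑ g + m * B ≤ ∑ (g ∘ c) + n * B
∑-outside-≤ {m} {n} {c} c-inj g B g≤B = begin
  ∑ g + m * B                                   ≡⟨ cong (λ x → ∑ g + x * B) (sym (∑-fibre-1 c)) ⟩
  ∑ g + ∑ (fibre c) * B                         ≡⟨ cong (∑ g +_) (*-distribʳ-sum B (fibre c)) ⟩
  ∑ g + ∑ (λ v → fibre c v * B)                 ≡⟨ sym (∑-distrib-+ g (λ v → fibre c v * B)) ⟩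
  ∑ (λ v → g v + fibre c v * B)                 ≤⟨ ∑-mono-≤ pointwise ⟩
  ∑ (λ v → fibre c v * g v + B)                 ≡⟨ ∑-distrib-+ (λ v → fibre c v * g v) (λ _ → B) ⟩
  ∑ (λ v → fibre c v * g v) + ∑ {n} (λ _ → B)   ≡⟨ cong₂ _+_ (∑-fibre c g) (∑-const n B) ⟩
  ∑ (g ∘ c) + n * B ∎
  where
  open ≤-Reasoning
  pointwise : ∀ v → g v + fibre c v * B ≤ fibre c v * g v + B
  pointwise v with F.any? (λ k → c k F.≟ v)
  ... | yes (k , refl) rewrite fibre-∈ c-inj k | *-identityˡ (g (c k)) | *-identityˡ B = ≤-refl
  ... | no v∉c rewrite fibre-∉ {c = c} (λ k e → v∉c (k , e)) | +-identityʳ (g v) = g≤B v (λ k e → v∉c (k , e))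

-- Doubled edge counts of symmetric loopless matrices.

Symm Loopless Simple : ∀ {n} → Multigraph n → Set
Symm W = ∀ i j → W i j ≡ W j i
Loopless W = ∀ i → W i i ≡ 0
Simple W = ∀ i j → W i j ≤ 1

degree : ∀ {n} → Multigraph n → Fin n → ℕ
degree W i = ∑ (W i)

-- Every edge of a symmetric loopless W is counted twice.
total : ∀ {n} → Multigraph n → ℕ
total W = ∑ (degree W)

total-cong : ∀ {n} {V W : Multigraph n} → (∀ i j → V i j ≡ W i j) → total V ≡ total W
total-cong e = sum-cong-≗ (λ i → sum-cong-≗ (e i))

total-mono : ∀ {n} {V W : Multigraph n} → (∀ i j → V i j ≤ W i j) → total V ≤ total W
total-mono e = ∑-mono-≤ (λ i → ∑-mono-≤ (e i))

total-+ : ∀ {n} (V W : Multigraph n) → total (λ i j → V i j + W i j) ≡ total V + total W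
total-+ V W = trans (sum-cong-≗ (λ i → ∑-distrib-+ (V i) (W i))) (∑-distrib-+ (degree V) (degree W))

total-swap : ∀ {n} (W : Multigraph n) → total (λ i j → W j i) ≡ total W
total-swap W = sym (∑-comm W)

total-remove : ∀ {n} {W : Multigraph (suc n)} → Symm W → Loopless W → ∀ k →
               total W ≡ 2 * degree W k + total (W on punchIn k)
total-remove {n} {W} sym-W loopless k = begin
  total W
    ≡⟨ sum-remove {i = k} (degree W) ⟩
  degree W k + ∑ (λ i → degree W (punchIn k i))
    ≡⟨ cong (degree W k +_) (sum-cong-≗ (λ i → sum-remove {i = k} (W (punchIn k i)))) ⟩
  degree W k + ∑ (λ i → W (punchIn k i) k + degree (W on punchIn k) i)
    ≡⟨ cong (degree W k +_) (∑-distrib-+ (λ i → W (punchIn k i) k) (degree (W on punchIn k))) ⟩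
  degree W k + (∑ (λ i → W (punchIn k i) k) + total (W on punchIn k))
    ≡⟨ cong (λ x → degree W k + (x + total (W on punchIn k))) column ⟩
  degree W k + (degree W k + total (W on punchIn k))
    ≡⟨ twice (degree W k) (total (W on punchIn k)) ⟩
  2 * degree W k + total (W on punchIn k) ∎
  where
  open ≡-Reasoning
  twice : ∀ x y → x + (x + y) ≡ 2 * x + y
  twice = solve-∀
  column : ∑ (λ i → W (punchIn k i) k) ≡ degree W k
  column = begin
    ∑ (λ i → W (punchIn k i) k)            ≡⟨ cong (_+ ∑ (λ i → W (punchIn k i) k)) (sym (loopless k)) ⟩
    W k k + ∑ (λ i → W (punchIn k i) k)    ≡⟨ sym (sum-remove {i = k} (λ i → W i k)) ⟩
    ∑ (λ i → W i k)                        ≡⟨ sum-cong-≗ (λ i → sym-W i k) ⟩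
    degree W k ∎

-- Each pair is lost in exactly two of the `suc n` vertex deletions.
total-average : ∀ {n} {W : Multigraph (suc n)} → Symm W → Loopless W →
                suc n * total W ≡ 2 * total W + ∑ (λ k → total (W on punchIn k))
total-average {n} {W} sym-W loopless = begin
  suc n * total W
    ≡⟨ sym (∑-const (suc n) (total W)) ⟩
  ∑ {suc n} (λ _ → total W)
    ≡⟨ sum-cong-≗ (total-remove sym-W loopless) ⟩
  ∑ (λ k → 2 * degree W k + total (W on punchIn k))
    ≡⟨ ∑-distrib-+ (λ k → 2 * degree W k) (λ k → total (W on punchIn k)) ⟩
  ∑ (λ k → 2 * degree W k) + ∑ (λ k → total (W on punchIn k))
    ≡⟨ cong (_+ ∑ (λ k → total (W on punchIn k))) (sym (*-distribˡ-sum 2 (degree W))) ⟩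
  2 * total W + ∑ (λ k → total (W on punchIn k)) ∎
  where open ≡-Reasoning

-- From edge counts over lists of pairs to double sums.

upper : ∀ {n} → Multigraph n → Multigraph n
upper w i j = if does (i F.<? j) then w i j else 0

-- Only entries with `i < j` carry meaning, so the diagonal is overwritten by 0 and the lower half
-- by the reflection of the upper half.
symmetrise : ∀ {n} → Multigraph n → Multigraph n
symmetrise w i j = upper w i j + upper w j i

upper-< : ∀ {n} (w : Multigraph n) {i j} → i F.< j → upper w i j ≡ w i j
upper-< w {i} {j} i<j rewrite dec-true (i F.<? j) i<j = refl

upper-≮ : ∀ {n} (w : Multigraph n) {i j} → ¬ i F.< j → upper w i j ≡ 0
upper-≮ w {i} {j} i≮j rewrite dec-false (i F.<? j) i≮j = refl

symmetrise-symm : ∀ {n} (w : Multigraph n) → Symm (symmetrise w)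
symmetrise-symm w i j = +-comm (upper w i j) (upper w j i)

symmetrise-loopless : ∀ {n} (w : Multigraph n) → Loopless (symmetrise w)
symmetrise-loopless w i = cong₂ _+_ (upper-≮ w {i} {i} (<-irrefl refl)) (upper-≮ w {i} {i} (<-irrefl refl))

symmetrise-< : ∀ {n} (w : Multigraph n) {i j} → i F.< j → symmetrise w i j ≡ w i j
symmetrise-< w {i} {j} i<j = trans (cong₂ _+_ (upper-< w i<j) (upper-≮ w {j} {i} (<-asym i<j))) (+-identityʳ _)

symmetrise-fix : ∀ {n} {W : Multigraph n} → Symm W → Loopless W → ∀ i j → symmetrise W i j ≡ W i j
symmetrise-fix {W = W} sym-W loopless i j with F.<-cmp i j
... | tri< i<j _ _  = symmetrise-< W i<j
... | tri≈ _ refl _ = trans (symmetrise-loopless W i) (sym (loopless i))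
... | tri> _ _ j<i  = trans (symmetrise-symm W i j) (trans (symmetrise-< W j<i) (sym-W j i))

sum-map-filter : ∀ {A : Set} {P : A → Set} (P? : Decidable P) (g : A → ℕ) xs →
                 sum (map g (filter P? xs)) ≡ sum (map (λ x → if does (P? x) then g x else 0) xs)
sum-map-filter P? g []       = refl
sum-map-filter P? g (x ∷ xs) with does (P? x)
... | true  = cong (g x +_) (sum-map-filter P? g xs)
... | false = sum-map-filter P? g xs

sum-map-cartesianProduct : ∀ {A B : Set} (g : A × B → ℕ) xs ys →
  sum (map g (cartesianProduct xs ys)) ≡ sum (map (λ x → sum (map (λ y → g (x , y)) ys)) xs)
sum-map-cartesianProduct g []       ys = refl
sum-map-cartesianProduct g (x ∷ xs) ys = begin
  sum (map g (map (x ,_) ys ++ cartesianProduct xs ys))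
    ≡⟨ cong sum (map-++ g (map (x ,_) ys) _) ⟩
  sum (map g (map (x ,_) ys) ++ map g (cartesianProduct xs ys))
    ≡⟨ sum-++ (map g (map (x ,_) ys)) _ ⟩
  sum (map g (map (x ,_) ys)) + sum (map g (cartesianProduct xs ys))
    ≡⟨ cong₂ _+_ (cong sum (sym (map-∘ ys))) (sum-map-cartesianProduct g xs ys) ⟩
  sum (map (λ y → g (x , y)) ys) + sum (map (λ x → sum (map (λ y → g (x , y)) ys)) xs) ∎
  where open ≡-Reasoning

sum-map-allFin : ∀ {n} (f : Fin n → ℕ) → sum (map f (allFin n)) ≡ ∑ f
sum-map-allFin f = trans (cong sum (map-tabulate id f)) (sum-tabulate f)
  where
  sum-tabulate : ∀ {n} (f : Fin n → ℕ) → sum (tabulate f) ≡ ∑ f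
  sum-tabulate {zero}  f = refl
  sum-tabulate {suc n} f = cong (f zero +_) (sum-tabulate (f ∘ suc))

edges-upper : ∀ {n} (w : Multigraph n) → edges w ≡ total (upper w)
edges-upper {n} w = begin
  edges w
    ≡⟨ sum-map-filter (λ p → proj₁ p F.<? proj₂ p) (λ p → w (proj₁ p) (proj₂ p))
         (cartesianProduct (allFin n) (allFin n)) ⟩
  sum (map (λ p → upper w (proj₁ p) (proj₂ p)) (cartesianProduct (allFin n) (allFin n)))
    ≡⟨ sum-map-cartesianProduct (λ p → upper w (proj₁ p) (proj₂ p)) (allFin n) (allFin n) ⟩
  sum (map (λ i → sum (map (upper w i) (allFin n))) (allFin n))
    ≡⟨ sum-map-allFin (λ i → sum (map (upper w i) (allFin n))) ⟩
  ∑ (λ i → sum (map (upper w i) (allFin n)))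
    ≡⟨ sum-cong-≗ (λ i → sum-map-allFin (upper w i)) ⟩
  total (upper w) ∎
  where open ≡-Reasoning

2*edges≡total : ∀ {n} (w : Multigraph n) → 2 * edges w ≡ total (symmetrise w)
2*edges≡total w = begin
  2 * edges w                                   ≡⟨ cong (2 *_) (edges-upper w) ⟩
  2 * total (upper w)                           ≡⟨ cong (total (upper w) +_) (+-identityʳ _) ⟩
  total (upper w) + total (upper w)             ≡⟨ cong (total (upper w) +_) (sym (total-swap (upper w))) ⟩
  total (upper w) + total (λ i j → upper w j i) ≡⟨ sym (total-+ (upper w) (λ i j → upper w j i)) ⟩
  total (symmetrise w) ∎
  where open ≡-Reasoning

-- Makes the evenness of the doubled count visible, on which every rounding step depends.
total-even : ∀ {n} {W : Multigraph n} → Symm W → Loopless W → total W ≡ 2 * edges W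
total-even {W = W} sym-W loopless =
  trans (total-cong (λ i j → sym (symmetrise-fix sym-W loopless i j))) (sym (2*edges≡total W))

bit : Bool → ℕ
bit b = if b then 1 else 0

-- Testing against all weight functions stands in for a bijection from `Fin m` to `X`; applied once
-- per index it converts double sums.
Enumerates : ∀ {m n} → (Fin m → Fin n) → Subset n → Set
Enumerates c X = ∀ g → ∑ (λ v → bit (lookup X v) * g v) ≡ ∑ (g ∘ c)

2*edgesIn≡total : ∀ {m n} {c : Fin m → Fin n} {X : Subset n} → Enumerates c X →
                  ∀ w → 2 * edgesIn w X ≡ total (symmetrise w on c)
2*edgesIn≡total {c = c} {X} enum w = begin
  2 * edgesIn w X
    ≡⟨ 2*edges≡total masked ⟩
  total (symmetrise masked)
    ≡⟨ total-cong symmetrise-masked ⟩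
  ∑ (λ i → ∑ (λ j → x i * (x j * symmetrise w i j)))
    ≡⟨ sum-cong-≗ (λ i → sym (*-distribˡ-sum (x i) (λ j → x j * symmetrise w i j))) ⟩
  ∑ (λ i → x i * ∑ (λ j → x j * symmetrise w i j))
    ≡⟨ enum (λ i → ∑ (λ j → x j * symmetrise w i j)) ⟩
  ∑ (λ k → ∑ (λ j → x j * symmetrise w (c k) j))
    ≡⟨ sum-cong-≗ (λ k → enum (symmetrise w (c k))) ⟩
  total (symmetrise w on c) ∎
  where
  open ≡-Reasoning
  x = λ v → bit (lookup X v)
  masked : Multigraph _
  masked i j = if lookup X i ∧ lookup X j then w i j else 0
  upper-masked : ∀ i j → upper masked i j ≡ x i * (x j * upper w i j)
  upper-masked i j with does (i F.<? j) | lookup X i | lookup X j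
  ... | true  | true  | true  = sym (trans (*-identityˡ _) (*-identityˡ _))
  ... | true  | true  | false = refl
  ... | true  | false | _     = refl
  ... | false | true  | true  = refl
  ... | false | true  | false = refl
  ... | false | false | _     = refl
  factor : ∀ x y u v → x * (y * u) + y * (x * v) ≡ x * (y * (u + v))
  factor = solve-∀
  symmetrise-masked : ∀ i j → symmetrise masked i j ≡ x i * (x j * symmetrise w i j)
  symmetrise-masked i j = trans (cong₂ _+_ (upper-masked i j) (upper-masked j i)) (factor (x i) (x j) _ _)

image : ∀ {m n} → (Fin m → Fin n) → Subset n
image c = Vec.tabulate (λ v → does (F.any? (λ k → c k F.≟ v)))

bit-image : ∀ {m n} {c : Fin m → Fin n} → Inj c → ∀ v → bit (lookup (image c) v) ≡ fibre c v
bit-image {c = c} c-inj v rewrite lookup∘tabulate (λ v → does (F.any? (λ k → c k F.≟ v))) v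
  with F.any? (λ k → c k F.≟ v)
... | yes (k , refl) = sym (fibre-∈ c-inj k)
... | no v∉c         = sym (fibre-∉ {c = c} (λ k e → v∉c (k , e)))

image-enumerates : ∀ {m n} {c : Fin m → Fin n} → Inj c → Enumerates c (image c)
image-enumerates {c = c} c-inj g = trans (sum-cong-≗ (λ v → cong (_* g v) (bit-image c-inj v))) (∑-fibre c g)

∣∣≡∑ : ∀ {n} (X : Subset n) → ∣ X ∣ ≡ ∑ (λ v → bit (lookup X v))
∣∣≡∑ Vec.[]            = refl
∣∣≡∑ (true Vec.∷ X)  = cong suc (∣∣≡∑ X)
∣∣≡∑ (false Vec.∷ X) = ∣∣≡∑ X

∣image∣ : ∀ {m n} {c : Fin m → Fin n} → Inj c → ∣ image c ∣ ≡ m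
∣image∣ {c = c} c-inj = trans (∣∣≡∑ (image c)) (trans (sum-cong-≗ (bit-image c-inj)) (∑-fibre-1 c))

elements : ∀ {n} (X : Subset n) → Fin ∣ X ∣ → Fin n
elements (true  Vec.∷ X) zero    = zero
elements (true  Vec.∷ X) (suc k) = suc (elements X k)
elements (false Vec.∷ X) k       = suc (elements X k)

elements-injective : ∀ {n} (X : Subset n) → Inj (elements X)
elements-injective (true  Vec.∷ X) {zero}  {zero}  e = refl
elements-injective (true  Vec.∷ X) {suc i} {suc j} e = cong suc (elements-injective X (F.suc-injective e))
elements-injective (false Vec.∷ X) e = elements-injective X (F.suc-injective e)

elements-enumerates : ∀ {n} (X : Subset n) → Enumerates (elements X) X
elements-enumerates Vec.[]            g = refl
elements-enumerates (true  Vec.∷ X) g = cong₂ _+_ (*-identityˡ (g zero)) (elements-enumerates X (g ∘ suc))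
elements-enumerates (false Vec.∷ X) g = elements-enumerates X (g ∘ suc)

-- Parity and the arithmetic of averaging.

consecutive-even : ∀ m → ∃ λ c → m * suc m ≡ 2 * c
consecutive-even zero = 0 , refl
consecutive-even (suc m) with consecutive-even m
... | c , e = suc m + c , trans (step m) (trans (cong (2 * suc m +_) e) (sym (*-distribˡ-+ 2 (suc m) c)))
  where
  step : ∀ m → suc m * suc (suc m) ≡ 2 * suc m + m * suc m
  step = solve-∀

even-gap : ∀ {x y} → 2 * x < 2 * y → 2 * x + 2 ≤ 2 * y
even-gap {x} {y} lt = subst (_≤ 2 * y) (trans (*-suc 2 x) (+-comm 2 (2 * x))) (*-monoʳ-≤ 2 (*-cancelˡ-< 2 x y lt))

-- Here `h` and `h + k` are the values of `missing` at `1 + m` and `2 + m`, `2 * e` is the total on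
-- `2 + m` points, and `A` is the sum over its deletions. Averaging gives m e ≤ m b C(m+2,2) - (m+2)
-- h, and the first hypothesis says m (h + k - 1) < (m+2) h. By integrality e ≤ b C(m+2,2) - (h +
-- k).
averaging-arithmetic : ∀ m b h k e A → m * k < 2 * h + m →
  A + (2 + m) * (2 * h + b * (1 + m)) ≤ (2 + m) * (b * (1 + m) * (1 + m)) →
  (2 + m) * (2 * e) ≡ 2 * (2 * e) + A →
  2 * e + 2 * (h + k) + b * (2 + m) ≤ b * (2 + m) * (2 + m)
averaging-arithmetic m b h k e A numeric average total≡ = ≮⇒≥ λ over →
  -- The assumed excess taken `m` times, the averaged bound once and `numeric` twice add up to 2 + X
  -- ≤ X.
  <⇒≱ (m<n+m _ {2} (s≤s z≤n)) (≤-trans (≤-reflexive (sym (balance m b h k e)))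
    (+-mono-≤ (+-mono-≤ (*-monoʳ-≤ m (excess over))
                        (subst (λ A → A + (2 + m) * (2 * h + b * (1 + m)) ≤ (2 + m) * (b * (1 + m) * (1 + m))) A≡ average))
              (*-monoʳ-≤ 2 numeric)))
  where
  C = proj₁ (consecutive-even (1 + m))
  2C : (1 + m) * (2 + m) ≡ 2 * C
  2C = proj₂ (consecutive-even (1 + m))
  A≡ : A ≡ m * (2 * e)
  A≡ = +-cancelˡ-≡ (2 * (2 * e)) _ _ (trans (sym total≡) (*-distribʳ-+ (2 * e) 2 m))
  even-bound : b * ((1 + m) * (2 + m)) ≡ 2 * (b * C)
  even-bound = trans (cong (b *_) 2C) (lem b C)
    where
    lem : ∀ b C → b * (2 * C) ≡ 2 * (b * C)
    lem = solve-∀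
  split : ∀ m b → b * (2 + m) * (2 + m) ≡ b * ((1 + m) * (2 + m)) + b * (2 + m)
  split = solve-∀
  join : ∀ e h k → 2 * e + 2 * (h + k) ≡ 2 * (e + h + k)
  join = solve-∀
  excess : b * (2 + m) * (2 + m) < 2 * e + 2 * (h + k) + b * (2 + m) →
           b * ((1 + m) * (2 + m)) + 2 ≤ 2 * (e + h + k)
  excess over = subst (λ z → z + 2 ≤ 2 * (e + h + k)) (sym even-bound)
    (even-gap {b * C} {e + h + k} (subst₂ _<_ even-bound (join e h k)
      (+-cancelʳ-< (b * (2 + m)) _ _ (subst (_< 2 * e + 2 * (h + k) + b * (2 + m)) (split m b) over))))
  balance : ∀ m b h k e →
    m * (b * ((1 + m) * (2 + m)) + 2) + (m * (2 * e) + (2 + m) * (2 * h + b * (1 + m))) + 2 * suc (m * k)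
    ≡ 2 + (m * (2 * (e + h + k)) + (2 + m) * (b * (1 + m) * (1 + m)) + 2 * (2 * h + m))
  balance = solve-∀

-- Graphs with a nonadjacent pair, and twins.

total-δ : ∀ n → total (δ {n}) ≡ n
total-δ n = trans (sum-cong-≗ {n} (λ i → trans (sum-cong-≗ (λ j → sym (*-identityʳ (δ i j)))) (∑-δ i (λ _ → 1))))
  (trans (∑-const n 1) (*-identityʳ n))

total-δδ : ∀ {n} (i j : Fin n) → total (λ u v → δ i u * δ j v) ≡ 1
total-δδ i j = begin
  ∑ (λ u → ∑ (λ v → δ i u * δ j v))  ≡⟨ sum-cong-≗ (λ u → sym (*-distribˡ-sum (δ i u) (δ j))) ⟩
  ∑ (λ u → δ i u * ∑ (δ j))          ≡⟨ ∑-δ i (λ _ → ∑ (δ j)) ⟩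
  ∑ (δ j)                            ≡⟨ sum-cong-≗ (λ v → sym (*-identityʳ (δ j v))) ⟩
  ∑ (λ v → δ j v * 1)                ≡⟨ ∑-δ j (λ _ → 1) ⟩
  1 ∎
  where open ≡-Reasoning

total-1 : ∀ n → total {n} (λ _ _ → 1) ≡ n * n
total-1 n = trans (sum-cong-≗ {n} (λ i → trans (∑-const n 1) (*-identityʳ n))) (∑-const n n)

-- The identity matrix and the two entries at the nonedge fit into zeros of `W`, so the sum of all
-- these stays below the all-ones matrix.
total-nonedge : ∀ {n} {W : Multigraph n} → Symm W → Loopless W → Simple W → ∀ {i j} → i ≢ j → W i j ≡ 0 →
                total W + 2 + n ≤ n * n
total-nonedge {n} {W} sym-W loopless simple {i} {j} i≢j Wij≡0 = begin
  total W + 2 + n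
    ≡⟨ lem (total W) n ⟩
  total W + n + (1 + 1)
    ≡⟨ sym (cong₂ (λ x y → total W + x + y) (total-δ n) (cong₂ _+_ (total-δδ i j) (total-δδ j i))) ⟩
  total W + total (δ {n}) + (total (λ u v → δ i u * δ j v) + total (λ u v → δ j u * δ i v))
    ≡⟨ sym (cong₂ _+_ (total-+ W (δ {n})) (total-+ (λ u v → δ i u * δ j v) (λ u v → δ j u * δ i v))) ⟩
  total (λ u v → W u v + δ u v) + total (λ u v → δ i u * δ j v + δ j u * δ i v)
    ≡⟨ sym (total-+ (λ u v → W u v + δ u v) (λ u v → δ i u * δ j v + δ j u * δ i v)) ⟩
  total (λ u v → W u v + δ u v + (δ i u * δ j v + δ j u * δ i v))
    ≤⟨ total-mono pointwise ⟩
  total {n} (λ _ _ → 1)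
    ≡⟨ total-1 n ⟩
  n * n ∎
  where
  open ≤-Reasoning
  lem : ∀ t n → t + 2 + n ≡ t + n + (1 + 1)
  lem = solve-∀
  pointwise : ∀ u v → W u v + δ u v + (δ i u * δ j v + δ j u * δ i v) ≤ 1
  pointwise u v with u F.≟ v
  pointwise u .u | yes refl rewrite loopless u with i F.≟ u | j F.≟ u
  ... | yes refl | yes j≡i = contradiction (sym j≡i) i≢j
  ... | yes refl | no _    = ≤-refl
  ... | no _     | yes _   = ≤-refl
  ... | no _     | no _    = ≤-refl
  pointwise u v | no u≢v with i F.≟ u | j F.≟ v | j F.≟ u | i F.≟ v
  ... | yes refl | yes refl | yes j≡i | _ = contradiction (sym j≡i) i≢j
  ... | yes refl | yes refl | no _ | _ rewrite Wij≡0 = ≤-refl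
  ... | yes i≡u | no _ | yes j≡u | _ = contradiction (trans i≡u (sym j≡u)) i≢j
  ... | yes refl | no _ | no _ | _ rewrite +-identityʳ (W i v) | +-identityʳ (W i v) = simple i v
  ... | no i≢u | yes j≡v | yes j≡u | _ = contradiction (trans (sym j≡u) j≡v) u≢v
  ... | no _ | yes _ | no _ | _ rewrite +-identityʳ (W u v) | +-identityʳ (W u v) = simple u v
  ... | no _ | no _ | yes refl | yes refl rewrite sym-W j i | Wij≡0 = ≤-refl
  ... | no _ | no _ | yes _ | no _ rewrite +-identityʳ (W u v) | +-identityʳ (W u v) = simple u v
  ... | no _ | no _ | no _ | _ rewrite +-identityʳ (W u v) | +-identityʳ (W u v) = simple u v

replace : ∀ {n} → Fin n → Fin n → Fin n → Fin n
replace y x v = if does (v F.≟ y) then x else v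

replace-hit : ∀ {n} (y x : Fin n) → replace y x y ≡ x
replace-hit y x rewrite dec-true (y F.≟ y) refl = refl

replace-miss : ∀ {n} {y x v : Fin n} → v ≢ y → replace y x v ≡ v
replace-miss {y = y} {x} {v} v≢y rewrite dec-false (v F.≟ y) v≢y = refl

∑-replace : ∀ {n} (y x : Fin n) (g : Fin n → ℕ) → ∑ (g ∘ replace y x) + g y ≡ ∑ g + g x
∑-replace {suc n} y x g = begin
  ∑ (g ∘ replace y x) + g y
    ≡⟨ cong (_+ g y) (sum-remove {i = y} (g ∘ replace y x)) ⟩
  g (replace y x y) + ∑ (λ j → g (replace y x (punchIn y j))) + g y
    ≡⟨ cong₂ (λ u v → g u + v + g y) (replace-hit y x) (sum-cong-≗ (λ j → cong g (replace-miss (F.punchInᵢ≢i y j)))) ⟩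
  g x + ∑ (λ j → g (punchIn y j)) + g y
    ≡⟨ rotate (g x) (∑ (λ j → g (punchIn y j))) (g y) ⟩
  g y + ∑ (λ j → g (punchIn y j)) + g x
    ≡⟨ cong (_+ g x) (sym (sum-remove {i = y} g)) ⟩
  ∑ g + g x ∎
  where
  open ≡-Reasoning
  rotate : ∀ a b c → a + b + c ≡ c + b + a
  rotate = solve-∀

-- Making `y` a twin of `x` trades the edges at `y` for copies of those at `x`. Nonadjacency ensures
-- that no edge is counted at both. `∑-replace` is applied to rows and to columns.
total-replace : ∀ {n} {W : Multigraph n} → Symm W → Loopless W → ∀ {x y} → W x y ≡ 0 →
                total (W on replace y x) + 2 * degree W y ≡ total W + 2 * degree W x
total-replace {n} {W} sym-W loopless {x} {y} Wxy≡0 = begin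
  total (W on ρ) + 2 * degree W y                    ≡⟨ double (total (W on ρ)) (degree W y) ⟩
  total (W on ρ) + degree W y + degree W y           ≡⟨ cong (λ z → total (W on ρ) + z + degree W y) (sym G-y) ⟩
  ∑ (G ∘ ρ) + G y + degree W y                       ≡⟨ cong (_+ degree W y) (∑-replace y x G) ⟩
  ∑ G + G x + degree W y                             ≡⟨ cong (λ z → ∑ G + z + degree W y) G-x ⟩
  ∑ G + degree W x + degree W y                      ≡⟨ swap (∑ G) (degree W x) (degree W y) ⟩
  ∑ G + degree W y + degree W x                      ≡⟨ cong (λ z → ∑ G + z + degree W x) (column y) ⟩
  ∑ G + ∑ (λ u → W u y) + degree W x                 ≡⟨ cong (_+ degree W x) (sym (∑-distrib-+ G (λ u → W u y))) ⟩
  ∑ (λ u → G u + W u y) + degree W x                 ≡⟨ cong (_+ degree W x) (sum-cong-≗ (λ u → ∑-replace y x (W u))) ⟩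
  ∑ (λ u → degree W u + W u x) + degree W x          ≡⟨ cong (_+ degree W x) (∑-distrib-+ (degree W) (λ u → W u x)) ⟩
  total W + ∑ (λ u → W u x) + degree W x             ≡⟨ cong (λ z → total W + z + degree W x) (sym (column x)) ⟩
  total W + degree W x + degree W x                  ≡⟨ sym (double (total W) (degree W x)) ⟩
  total W + 2 * degree W x ∎
  where
  open ≡-Reasoning
  ρ = replace y x
  G : Fin n → ℕ
  G u = ∑ (W u ∘ ρ)
  double : ∀ t d → t + 2 * d ≡ t + d + d
  double = solve-∀
  swap : ∀ t d e → t + d + e ≡ t + e + d
  swap = solve-∀
  column : ∀ v → degree W v ≡ ∑ (λ u → W u v)
  column v = sum-cong-≗ (sym-W v)
  G-x : G x ≡ degree W x
  G-x = +-cancelʳ-≡ 0 _ _ (subst₂ (λ u v → G x + u ≡ degree W x + v) Wxy≡0 (loopless x) (∑-replace y x (W x)))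
  G-y : G y ≡ degree W y
  G-y = +-cancelʳ-≡ 0 _ _ (subst₂ (λ u v → G y + u ≡ degree W y + v) (loopless y) (trans (sym-W y x) Wxy≡0)
    (∑-replace y x (W y)))

-- Points are coloured one at a time; a point in a class of its own gets a fresh colour,
-- and then the remaining points have no r pairwise inequivalent ones.
colouring : ∀ n r (R : Fin n → Fin n → ℕ) → (∀ i → R i i ≡ 0) → (∀ i j → R i j ≡ R j i) →
            (∀ x y z → R x y ≡ 0 → R y z ≡ 0 → R x z ≡ 0) →
            ((c : Fin (suc r) → Fin n) → ∃₂ λ i j → i ≢ j × R (c i) (c j) ≡ 0) →
            Σ (Fin n → Fin r) λ f → ∀ i j → (f i ≡ f j → R i j ≡ 0) × (R i j ≡ 0 → f i ≡ f j)
colouring zero r R rf sm tr free = (λ ()) , λ ()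
colouring (suc n) r R rf sm tr free with F.any? (λ j → R zero (suc j) ≟ 0)
... | yes (j , R0j) = f , correct
  where
  tail = colouring n r (λ u v → R (suc u) (suc v)) (λ i → rf (suc i)) (λ u v → sm (suc u) (suc v))
           (λ x y z → tr (suc x) (suc y) (suc z)) (λ c → free (suc ∘ c))
  g = proj₁ tail
  f : Fin (suc n) → Fin r
  f zero    = g j
  f (suc i) = g i
  correct : ∀ u v → (f u ≡ f v → R u v ≡ 0) × (R u v ≡ 0 → f u ≡ f v)
  correct zero    zero    = (λ _ → rf zero) , (λ _ → refl)
  correct zero    (suc v) = (λ e → tr zero (suc j) (suc v) R0j (proj₁ (proj₂ tail j v) e)) ,
                            (λ e → proj₂ (proj₂ tail j v) (tr (suc j) zero (suc v) (trans (sm (suc j) zero) R0j) e))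
  correct (suc u) zero    = (λ e → tr (suc u) (suc j) zero (proj₁ (proj₂ tail u j) e) (trans (sm (suc j) zero) R0j)) ,
                            (λ e → proj₂ (proj₂ tail u j) (tr (suc u) zero (suc j) e R0j))
  correct (suc u) (suc v) = proj₂ tail u v
colouring (suc n) zero R rf sm tr free | no _ with free (λ _ → zero)
... | zero , zero , i≢j , _ = contradiction refl i≢j
colouring (suc n) (suc r) R rf sm tr free | no isolated = f , correct
  where
  tail-free : (c : Fin (suc r) → Fin n) → ∃₂ λ i j → i ≢ j × R (suc (c i)) (suc (c j)) ≡ 0
  tail-free c with free (λ { zero → zero ; (suc k) → suc (c k) })
  ... | zero  , zero  , i≢j , e = contradiction refl i≢j
  ... | zero  , suc j , i≢j , e = contradiction (c j , e) isolated
  ... | suc i , zero  , i≢j , e = contradiction (c i , trans (sm zero (suc (c i))) e) isolated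
  ... | suc i , suc j , i≢j , e = i , j , i≢j ∘ cong suc , e
  tail = colouring n r (λ u v → R (suc u) (suc v)) (λ i → rf (suc i)) (λ u v → sm (suc u) (suc v))
           (λ x y z → tr (suc x) (suc y) (suc z)) tail-free
  f : Fin (suc n) → Fin (suc r)
  f zero    = zero
  f (suc i) = suc (proj₁ tail i)
  correct : ∀ u v → (f u ≡ f v → R u v ≡ 0) × (R u v ≡ 0 → f u ≡ f v)
  correct zero    zero    = (λ _ → rf zero) , (λ _ → refl)
  correct zero    (suc v) = (λ ()) , (λ e → contradiction (v , e) isolated)
  correct (suc u) zero    = (λ ()) , (λ e → contradiction (u , trans (sm zero (suc u)) e) isolated)
  correct (suc u) (suc v) = (λ e → proj₁ (proj₂ tail u v) (F.suc-injective e)) ,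
                            (λ e → cong suc (proj₂ (proj₂ tail u v) e))

-- Arithmetic behind enlarging an overfull set.

-- For an overfull m-set with `e` edges and degree sum `D`, where `h` is `missing m` and `k` is
-- `m / r`, the nonadjacent ordered pairs from the set to all n vertices are counted twice. Their
-- number is n m - D, at most m (1 + K) by the degree condition; `outside` and `excess` bound it
-- from below.
growth-arithmetic : ∀ m y e h k K D r → let n = m + 2 + y; Q = 2 * e + 2 * h + 2 * k; U = m * m + m in
  n * Q + 2 * D + m * U ≤ (m * Q + 2 * (2 * e)) + n * U →
  m * m + 2 ≤ 2 * e + 2 * h + m →
  m * n ≤ D + m * (1 + K) →
  1 + K * r ≤ n →
  r * (y * (1 + k) + 2 * h + 2 * k) + m ≤ m * (m + 2 + y)
growth-arithmetic m y e h k K D r outside excess degrees K-bound = begin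
  r * (y * (1 + k) + 2 * h + 2 * k) + m  ≤⟨ +-monoˡ-≤ m (*-monoʳ-≤ r combined) ⟩
  r * (m * K) + m                        ≡⟨ regroup r m K ⟩
  m * (1 + K * r)                        ≤⟨ *-monoʳ-≤ m K-bound ⟩
  m * (m + 2 + y) ∎
  where
  open ≤-Reasoning
  regroup : ∀ r m K → r * (m * K) + m ≡ m * (1 + K * r)
  regroup = solve-∀
  common = m * (2 * e + 2 * h + 2 * k) + 4 * e + (m + 2 + y) * (m * m + m) + y * (2 * e + 2 * h + m) + 2 * D + 2 * m
  left : ∀ m y e h k D →
    (m + 2 + y) * (2 * e + 2 * h + 2 * k) + 2 * D + m * (m * m + m) + y * (m * m + 2) + 2 * (m * (m + 2 + y))
    ≡ 2 * (y * (1 + k) + 2 * h + 2 * k)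
      + (m * (2 * e + 2 * h + 2 * k) + 4 * e + (m + 2 + y) * (m * m + m) + y * (2 * e + 2 * h + m) + 2 * D + 2 * m)
  left = solve-∀
  right : ∀ m y e h k D K →
    (m * (2 * e + 2 * h + 2 * k) + 2 * (2 * e)) + (m + 2 + y) * (m * m + m) + y * (2 * e + 2 * h + m) + 2 * (D + m * (1 + K))
    ≡ 2 * (m * K)
      + (m * (2 * e + 2 * h + 2 * k) + 4 * e + (m + 2 + y) * (m * m + m) + y * (2 * e + 2 * h + m) + 2 * D + 2 * m)
  right = solve-∀
  -- There are `y + 2` outside vertices. `excess` is spent on `y` of them, each missing at least
  -- `1 + k` vertices of the set. In the bound for the other two, `2 * e` occurs and cancels against
  -- the m² - 2e nonadjacent pairs inside the set.
  combined : y * (1 + k) + 2 * h + 2 * k ≤ m * K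
  combined = *-cancelˡ-≤ 2 (+-cancelʳ-≤ common _ _ (subst₂ _≤_ (left m y e h k D) (right m y e h k D K)
    (+-mono-≤ (+-mono-≤ outside (*-monoʳ-≤ y excess)) (*-monoʳ-≤ 2 degrees))))

-- The coefficient of `y` in left minus right is r (1 + k) - m = r - i = 1 + j > 0, so a large `y`
-- is impossible, and y ≥ r m is large enough. In terms of `i`, `j`, `z`, once `closed` has
-- eliminated `h`, the difference is a successor with nonnegative coefficients, as `final` shows.
growth-impossible : ∀ i j z h k → let r = i + suc j; q = k * r; m = i + q; y = r * m + z in
  2 * h + q ≡ k * (2 * i + q) → 0 < k → ¬ (r * (y * (1 + k) + 2 * h + 2 * k) + m ≤ m * (m + 2 + y))
growth-impossible i j z h (suc k) closed _ le = m+1+n≰m R (begin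
    R + suc (k * r + (i + j) + (r * m * j + z * (1 + j) + j * i))
      ≡⟨ sym (final i j z k) ⟩
    r * (y * (1 + suc k) + 2 * suc k) + m + r * (suc k * (2 * i + q))
      ≡⟨ cong (λ x → r * (y * (1 + suc k) + 2 * suc k) + m + r * x) (sym closed) ⟩
    r * (y * (1 + suc k) + 2 * suc k) + m + r * (2 * h + q)
      ≡⟨ regroup i j z h k ⟩
    r * (y * (1 + suc k) + 2 * h + 2 * suc k) + m + r * q
      ≤⟨ +-monoˡ-≤ (r * q) le ⟩
    R ∎)
  where
  open ≤-Reasoning
  r = i + suc j
  q = suc k * r
  m = i + q
  y = r * m + z
  R = m * (m + 2 + y) + r * q
  regroup : ∀ i j z h k → let r = i + suc j; q = suc k * r; m = i + q; y = r * m + z in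
    r * (y * (1 + suc k) + 2 * suc k) + m + r * (2 * h + q)
    ≡ r * (y * (1 + suc k) + 2 * h + 2 * suc k) + m + r * q
  regroup = solve-∀
  final : ∀ i j z k → let r = i + suc j; q = suc k * r; m = i + q; y = r * m + z in
    r * (y * (1 + suc k) + 2 * suc k) + m + r * (suc k * (2 * i + q))
    ≡ m * (m + 2 + y) + r * q + suc (k * r + (i + j) + (r * m * j + z * (1 + j) + j * i))
  final = solve-∀

-- The integral AM-GM inequality.

Near : ℕ → ℕ → Set
Near a w = w ≡ a ⊎ w ≡ suc a

module AMGM (a : ℕ) .{{a≢0 : NonZero a}} where

  private b = suc a

  near-equality : ∀ {w} → Near a w → w * (a ^ w * b ^ a) ≡ a * (a ^ a * b ^ w)
  near-equality (inj₁ refl) = refl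
  near-equality (inj₂ refl) = lem a (a ^ a) (b ^ a)
    where
    lem : ∀ a x y → suc a * (a * x * y) ≡ a * (x * (suc a * y))
    lem = solve-∀

  -- Bernoulli's inequality 1 + (d+1)/a ≤ (1 + 1/a)^(d+1) with denominators cleared; it is strict
  -- from the second power on.
  above : ∀ d → (a + suc d) * a ^ suc d ≤ a * b ^ suc d
  above-strict : ∀ d → (a + suc (suc d)) * a ^ suc (suc d) < a * b ^ suc (suc d)

  above zero = ≤-reflexive (lem a)
    where
    lem : ∀ a → (a + 1) * (a * 1) ≡ a * (suc a * 1)
    lem = solve-∀
  above (suc d) = <⇒≤ (above-strict d)

  above-strict d = begin-strict
    (a + suc (suc d)) * (a * a ^ suc d)     ≡⟨ lem₁ a d (a ^ suc d) ⟩
    (a + suc d) * a ^ suc d * a + a * a ^ suc d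
      <⟨ +-monoʳ-< ((a + suc d) * a ^ suc d * a) (*-monoˡ-< (a ^ suc d) {{m^n≢0 a (suc d)}} (m<m+n a (s≤s z≤n))) ⟩
    (a + suc d) * a ^ suc d * a + (a + suc d) * a ^ suc d
      ≡⟨ lem₂ a ((a + suc d) * a ^ suc d) ⟩
    b * ((a + suc d) * a ^ suc d)           ≤⟨ *-monoʳ-≤ b (above d) ⟩
    b * (a * b ^ suc d)                     ≡⟨ lem₃ a (b ^ suc d) ⟩
    a * (b * b ^ suc d) ∎
    where
    open ≤-Reasoning
    lem₁ : ∀ a d x → (a + suc (suc d)) * (a * x) ≡ (a + suc d) * x * a + a * x
    lem₁ = solve-∀
    lem₂ : ∀ a x → x * a + x ≡ suc a * x
    lem₂ = solve-∀
    lem₃ : ∀ a x → suc a * (a * x) ≡ a * (suc a * x)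
    lem₃ = solve-∀

  -- The values below `a`: each step of the induction uses w (a + 1) < a (w + 1), true since w < a.
  below : ∀ j w → w + j ≡ a → w * b ^ j ≤ a * a ^ j
  below-strict : ∀ j w → w + suc j ≡ a → w * b ^ suc j < a * a ^ suc j

  below zero    w e = ≤-reflexive (cong (_* 1) (trans (sym (+-identityʳ w)) e))
  below (suc j) w e = <⇒≤ (below-strict j w e)

  below-strict j w e = begin-strict
    w * (b * b ^ j)                   ≡⟨ lem₁ w a (b ^ j) ⟩
    w * b ^ j * a + w * b ^ j
      <⟨ +-monoʳ-< (w * b ^ j * a) (*-monoˡ-< (b ^ j) {{m^n≢0 b j}} (subst (w <_) e (m<m+n w (s≤s z≤n)))) ⟩
    w * b ^ j * a + a * b ^ j         ≡⟨ lem₂ w a (b ^ j) ⟩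
    a * (suc w * b ^ j)               ≤⟨ *-monoʳ-≤ a (below j (suc w) (trans (sym (+-suc w j)) e)) ⟩
    a * (a * a ^ j) ∎
    where
    open ≤-Reasoning
    lem₁ : ∀ w a x → w * (suc a * x) ≡ w * x * a + w * x
    lem₁ = solve-∀
    lem₂ : ∀ w a x → w * x * a + a * x ≡ a * (suc w * x)
    lem₂ = solve-∀

  -- w ≤ a (1 + 1/a)^(w - a), with equality only at w = a, a + 1.
  tangent : ∀ w → Near a w ⊎ w * (a ^ w * b ^ a) < a * (a ^ a * b ^ w)
  tangent w with ≤-total a w
  ... | inj₁ a≤w = subst (λ w → Near a w ⊎ w * (a ^ w * b ^ a) < a * (a ^ a * b ^ w)) (m+[n∸m]≡n a≤w) (go (w ∸ a))
    where
    go : ∀ d → Near a (a + d) ⊎ (a + d) * (a ^ (a + d) * b ^ a) < a * (a ^ a * b ^ (a + d))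
    go zero          = inj₁ (inj₁ (+-identityʳ a))
    go (suc zero)    = inj₁ (inj₂ (+-comm a 1))
    go d@(suc (suc d′)) = inj₂ (subst₂ _<_
      (trans (lem₁ (a + d) (a ^ d) (a ^ a) (b ^ a)) (cong (λ x → (a + d) * (x * b ^ a)) (sym (^-distribˡ-+-* a a d))))
      (trans (lem₂ a (b ^ d) (a ^ a) (b ^ a)) (cong (λ x → a * (a ^ a * x)) (sym (^-distribˡ-+-* b a d))))
      (*-monoˡ-< (a ^ a * b ^ a) {{m*n≢0 (a ^ a) (b ^ a) {{m^n≢0 a a}} {{m^n≢0 b a}}}} (above-strict d′)))
      where
      lem₁ : ∀ u x y z → u * x * (y * z) ≡ u * (y * x * z)
      lem₁ = solve-∀
      lem₂ : ∀ u x y z → u * x * (y * z) ≡ u * (y * (z * x))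
      lem₂ = solve-∀
  ... | inj₂ w≤a with a ∸ w in eq
  ... | zero  = inj₁ (inj₁ (≤-antisym w≤a (m∸n≡0⇒m≤n eq)))
  ... | suc j = inj₂ (subst₂ _<_
      (trans (lem₁ w (b ^ suc j) (a ^ w) (b ^ w)) (cong (λ x → w * (a ^ w * x))
        (trans (sym (^-distribˡ-+-* b w (suc j))) (cong (b ^_) w+j≡a))))
      (trans (lem₂ a (a ^ suc j) (a ^ w) (b ^ w)) (cong (λ x → a * (x * b ^ w))
        (trans (sym (^-distribˡ-+-* a w (suc j))) (cong (a ^_) w+j≡a))))
      (*-monoˡ-< (a ^ w * b ^ w) {{m*n≢0 (a ^ w) (b ^ w) {{m^n≢0 a w}} {{m^n≢0 b w}}}} (below-strict j w w+j≡a)))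
    where
    w+j≡a : w + suc j ≡ a
    w+j≡a = trans (cong (w +_) (sym eq)) (m+[n∸m]≡n w≤a)
    lem₁ : ∀ u x y z → u * x * (y * z) ≡ u * (y * (z * x))
    lem₁ = solve-∀
    lem₂ : ∀ u x y z → u * x * (y * z) ≡ u * (y * x * z)
    lem₂ = solve-∀

  -- Products of the two sides of `tangent` over a list. The right one depends on the list only
  -- through length and sum, so lists can be compared.
  tangentˡ tangentʳ : List ℕ → ℕ
  tangentˡ []      = 1
  tangentˡ (w ∷ L) = w * (a ^ w * b ^ a) * tangentˡ L
  tangentʳ []      = 1
  tangentʳ (w ∷ L) = a * (a ^ a * b ^ w) * tangentʳ L

  tangentˡ-closed : ∀ L → tangentˡ L ≡ product L * (a ^ sum L * (b ^ a) ^ length L)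
  tangentˡ-closed [] = refl
  tangentˡ-closed (w ∷ L) rewrite tangentˡ-closed L | ^-distribˡ-+-* a w (sum L) =
    lem w (a ^ w) (b ^ a) (product L) (a ^ sum L) ((b ^ a) ^ length L)
    where
    lem : ∀ w x y p z t → w * (x * y) * (p * (z * t)) ≡ w * p * (x * z * (y * t))
    lem = solve-∀

  tangentʳ-closed : ∀ L → tangentʳ L ≡ (a * a ^ a) ^ length L * b ^ sum L
  tangentʳ-closed [] = refl
  tangentʳ-closed (w ∷ L) rewrite tangentʳ-closed L | ^-distribˡ-+-* b w (sum L) =
    lem a (a ^ a) (b ^ w) ((a * a ^ a) ^ length L) (b ^ sum L)
    where
    lem : ∀ a x y z t → a * (x * y) * (z * t) ≡ a * x * z * (y * t)
    lem = solve-∀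

  tangentʳ-factor≢0 : ∀ w → NonZero (a * (a ^ a * b ^ w))
  tangentʳ-factor≢0 w = m*n≢0 a _ {{a≢0}} {{m*n≢0 (a ^ a) (b ^ w) {{m^n≢0 a a}} {{m^n≢0 b w}}}}

  tangentʳ≢0 : ∀ L → NonZero (tangentʳ L)
  tangentʳ≢0 []      = _
  tangentʳ≢0 (w ∷ L) = m*n≢0 _ _ {{tangentʳ-factor≢0 w}} {{tangentʳ≢0 L}}

  tangentˡ-near : ∀ {L} → All (Near a) L → tangentˡ L ≡ tangentʳ L
  tangentˡ-near []       = refl
  tangentˡ-near (p ∷ ps) = cong₂ _*_ (near-equality p) (tangentˡ-near ps)

  tangentˡ-< : ∀ L → All (Near a) L ⊎ tangentˡ L < tangentʳ L
  tangentˡ-< [] = inj₁ []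
  tangentˡ-< (w ∷ L) with tangent w | tangentˡ-< L
  ... | inj₁ p | inj₁ ps = inj₁ (p ∷ ps)
  ... | inj₁ p | inj₂ lt = inj₂ (subst (λ x → x * tangentˡ L < tangentʳ (w ∷ L)) (sym (near-equality p))
                                  (*-monoʳ-< (a * (a ^ a * b ^ w)) {{tangentʳ-factor≢0 w}} lt))
  ... | inj₂ lt | inj₁ ps = inj₂ (subst (λ x → w * (a ^ w * b ^ a) * x < tangentʳ (w ∷ L)) (sym (tangentˡ-near ps))
                                  (*-monoˡ-< (tangentʳ L) {{tangentʳ≢0 L}} lt))
  ... | inj₂ lt | inj₂ lt′ = inj₂ (*-mono-< lt lt′)

  -- For a fixed length, multiplying `tangent` over the entries bounds the product by a constant
  -- times (1 + 1/a)^sum, and `L′` attains this. The bound increases strictly with the sum, so a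
  -- smaller sum costs a strict inequality, and so does an entry other than `a` and `a + 1`.
  integral-AMGM : ∀ L L′ → length L ≡ length L′ → All (Near a) L′ → sum L ≤ sum L′ →
    product L < product L′ ⊎ (product L ≡ product L′ × All (Near a) L × sum L ≡ sum L′)
  integral-AMGM L L′ len near′ sum≤ = go (m≤n⇒m<n∨m≡n sum≤) (tangentˡ-< L)
    where
    K = (b ^ a) ^ length L
    M = (a * a ^ a) ^ length L
    K≢0 : NonZero K
    K≢0 = m^n≢0 (b ^ a) (length L) {{m^n≢0 b a}}
    M≢0 : NonZero M
    M≢0 = m^n≢0 (a * a ^ a) (length L) {{m*n≢0 a (a ^ a) {{a≢0}} {{m^n≢0 a a}}}}
    equality′ : product L′ * (a ^ sum L′ * K) ≡ M * b ^ sum L′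
    equality′ = trans (cong (λ l → product L′ * (a ^ sum L′ * (b ^ a) ^ l)) len)
      (trans (sym (tangentˡ-closed L′)) (trans (tangentˡ-near near′) (trans (tangentʳ-closed L′)
        (cong (λ l → (a * a ^ a) ^ l * b ^ sum L′) (sym len)))))
    tight-or-strict : All (Near a) L ⊎ tangentˡ L < tangentʳ L → product L * (a ^ sum L * K) ≤ M * b ^ sum L
    tight-or-strict (inj₁ near) = ≤-reflexive
      (trans (sym (tangentˡ-closed L)) (trans (tangentˡ-near near) (tangentʳ-closed L)))
    tight-or-strict (inj₂ lt) = <⇒≤ (subst₂ _<_ (tangentˡ-closed L) (tangentʳ-closed L) lt)
    go : sum L < sum L′ ⊎ sum L ≡ sum L′ → All (Near a) L ⊎ tangentˡ L < tangentʳ L →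
         product L < product L′ ⊎ (product L ≡ product L′ × All (Near a) L × sum L ≡ sum L′)
    go (inj₂ sum≡) (inj₁ near) = inj₂ (*-cancelʳ-≡ _ _ (a ^ sum L * K)
      {{m*n≢0 (a ^ sum L) K {{m^n≢0 a (sum L)}} {{K≢0}}}}
      (trans (trans (sym (tangentˡ-closed L)) (trans (tangentˡ-near near) (tangentʳ-closed L)))
        (sym (subst (λ σ → product L′ * (a ^ σ * K) ≡ M * b ^ σ) (sym sum≡) equality′))) , near , sum≡)
    go (inj₂ sum≡) (inj₂ lt) = inj₁ (*-cancelʳ-< (a ^ sum L * K) _ _
      (<-≤-trans (subst₂ _<_ (tangentˡ-closed L) (tangentʳ-closed L) lt)
        (≤-reflexive (sym (subst (λ σ → product L′ * (a ^ σ * K) ≡ M * b ^ σ) (sym sum≡) equality′)))))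
    go (inj₁ sum<) cases = inj₁ (*-cancelʳ-< (a ^ sum L′ * K) _ _ (begin-strict
      product L * (a ^ sum L′ * K)            ≡⟨ cong (λ σ → product L * (a ^ σ * K)) (sym σ′) ⟩
      product L * (a ^ (sum L + suc d) * K)   ≡⟨ cong (λ x → product L * (x * K)) (^-distribˡ-+-* a (sum L) (suc d)) ⟩
      product L * (a ^ sum L * a ^ suc d * K) ≡⟨ lem (product L) (a ^ sum L) (a ^ suc d) K ⟩
      product L * (a ^ sum L * K) * a ^ suc d ≤⟨ *-monoˡ-≤ (a ^ suc d) (tight-or-strict cases) ⟩
      M * b ^ sum L * a ^ suc d
        <⟨ *-monoʳ-< (M * b ^ sum L) {{m*n≢0 M (b ^ sum L) {{M≢0}} {{m^n≢0 b (sum L)}}}} (^-monoˡ-< (suc d) (n<1+n a)) ⟩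
      M * b ^ sum L * b ^ suc d
        ≡⟨ trans (*-assoc M _ _) (cong (M *_) (sym (^-distribˡ-+-* b (sum L) (suc d)))) ⟩
      M * b ^ (sum L + suc d)                 ≡⟨ cong (λ σ → M * b ^ σ) σ′ ⟩
      M * b ^ sum L′                          ≡⟨ sym equality′ ⟩
      product L′ * (a ^ sum L′ * K) ∎))
      where
      open ≤-Reasoning
      d = sum L′ ∸ suc (sum L)
      σ′ : sum L + suc d ≡ sum L′
      σ′ = trans (+-suc (sum L) d) (m+[n∸m]≡n sum<)
      lem : ∀ p x y k → p * (x * y * k) ≡ p * (x * k) * y
      lem = solve-∀

-- Multigraphs as a constant plus a simple graph.

weights : ∀ {n} → Multigraph n → List ℕ
weights {n} w = map (λ p → w (proj₁ p) (proj₂ p)) (pairs n)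

weights-All⁻ : ∀ {n} {w : Multigraph n} {P : ℕ → Set} → All P (weights w) → ∀ {i j} → i F.< j → P (w i j)
weights-All⁻ {n} {w} ps {i} {j} i<j = All.lookup (All.map⁻ ps)
  (∈-filter⁺ (λ p → proj₁ p F.<? proj₂ p) (∈-cartesianProduct⁺ (∈-allFin i) (∈-allFin j)) i<j)

weights-All⁺ : ∀ {n} {w : Multigraph n} {P : ℕ → Set} → (∀ {i j} → i F.< j → P (w i j)) → All P (weights w)
weights-All⁺ {n} {w} p = All.map⁺ (All.map p
  (All.all-filter (λ p → proj₁ p F.<? proj₂ p) (cartesianProduct (allFin n) (allFin n))))

weights-length : ∀ {n} (w v : Multigraph n) → length (weights w) ≡ length (weights v)
weights-length {n} w v = trans (length-map (λ p → w (proj₁ p) (proj₂ p)) (pairs n))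
  (sym (length-map (λ p → v (proj₁ p) (proj₂ p)) (pairs n)))

-- `W` is `a + H` off the diagonal and `H` on it, as one equation that can be summed over all
-- entries without cases.
Offset : ℕ → ∀ {n} → Multigraph n → Multigraph n → Set
Offset a W H = ∀ i j → W i j + a * δ i j ≡ a + H i j

offset-on : ∀ {a m n} {W H : Multigraph n} {c : Fin m → Fin n} → Inj c → Offset a W H → Offset a (W on c) (H on c)
offset-on {a} {W = W} {c = c} c-inj offset i j = trans (cong (λ x → W (c i) (c j) + a * x) δ-on) (offset (c i) (c j))
  where
  δ-on : δ i j ≡ δ (c i) (c j)
  δ-on with i F.≟ j
  ... | yes refl = sym (δ-refl (c i))
  ... | no i≢j   = sym (δ-≢ (i≢j ∘ c-inj))

total-scale : ∀ a {n} (W : Multigraph n) → total (λ i j → a * W i j) ≡ a * total W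
total-scale a W = trans (sum-cong-≗ (λ i → sym (*-distribˡ-sum a (W i)))) (sym (*-distribˡ-sum a (degree W)))

offset-total : ∀ {a n} {W H : Multigraph n} → Offset a W H → total W + a * n ≡ a * n * n + total H
offset-total {a} {n} {W} {H} offset = begin
  total W + a * n                             ≡⟨ cong (λ x → total W + a * x) (sym (total-δ n)) ⟩
  total W + a * total (δ {n})                 ≡⟨ cong (total W +_) (sym (total-scale a (δ {n}))) ⟩
  total W + total {n} (λ i j → a * δ i j)     ≡⟨ sym (total-+ W (λ i j → a * δ i j)) ⟩
  total (λ i j → W i j + a * δ i j)           ≡⟨ total-cong offset ⟩
  total (λ i j → a + H i j)                   ≡⟨ total-+ (λ _ _ → a) H ⟩
  total {n} (λ _ _ → a) + total H             ≡⟨ cong (_+ total H) constant ⟩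
  a * n * n + total H ∎
  where
  open ≡-Reasoning
  constant : total {n} (λ _ _ → a) ≡ a * n * n
  constant = trans (sum-cong-≗ {n} (λ i → ∑-const n a))
    (trans (∑-const n (n * a)) (trans (*-comm n (n * a)) (cong (_* n) (*-comm n a))))

-- The complete multipartite graph whose classes are the fibres of `f`.
cross : ∀ {n r} → (Fin n → Fin r) → Multigraph n
cross f i j = 1 ∸ δ (f i) (f j)

δ-symm : ∀ {n} (i j : Fin n) → δ i j ≡ δ j i
δ-symm i j with i F.≟ j
... | yes refl = sym (δ-refl i)
... | no i≢j   = sym (δ-≢ (i≢j ∘ sym))

δ≤1 : ∀ {n} (i j : Fin n) → δ i j ≤ 1
δ≤1 i j with does (i F.≟ j)
... | true  = ≤-refl
... | false = z≤n

cross-symm : ∀ {n r} (f : Fin n → Fin r) → Symm (cross f)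
cross-symm f i j = cong (1 ∸_) (δ-symm (f i) (f j))

cross-loopless : ∀ {n r} (f : Fin n → Fin r) → Loopless (cross f)
cross-loopless f i = cong (1 ∸_) (δ-refl (f i))

cross-simple : ∀ {n r} (f : Fin n → Fin r) → Simple (cross f)
cross-simple f i j = m∸n≤m 1 (δ (f i) (f j))

partMult-≡ : ∀ {r} a {x y : Fin r} → x ≡ y → partMult 0 a x y ≡ a
partMult-≡ a {x} refl rewrite dec-true (x F.≟ x) refl with does (toℕ x ≟ 0)
... | true  = refl
... | false = refl

partMult-≢ : ∀ {r} a {x y : Fin r} → x ≢ y → partMult 0 a x y ≡ suc a
partMult-≢ a {x} {y} x≢y rewrite dec-false (x F.≟ y) x≢y = refl

partMult-cross : ∀ {r n} a (f : Fin n → Fin r) i j → partMult 0 a (f i) (f j) ≡ a + cross f i j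
partMult-cross a f i j = by-cases (f i F.≟ f j)
  where
  by-cases : Dec (f i ≡ f j) → partMult 0 a (f i) (f j) ≡ a + cross f i j
  by-cases (yes e) = trans (partMult-≡ a e) (trans (sym (+-identityʳ a))
    (cong (a +_) (sym (trans (cong (λ x → 1 ∸ δ (f i) x) (sym e)) (cross-loopless f i)))))
  by-cases (no ne) = trans (partMult-≢ a ne) (trans (+-comm 1 a) (cong (λ x → a + (1 ∸ x)) (sym (δ-≢ ne))))

offset-offDiagonal : ∀ {a n} {W H : Multigraph n} → Symm W → Symm H → Loopless W → Loopless H →
                     (∀ {i j} → i F.< j → W i j ≡ a + H i j) → Offset a W H
offset-offDiagonal {a} {n} {W} {H} sym-W sym-H loopless-W loopless-H eq i j with F.<-cmp i j
... | tri< i<j i≢j _ = trans (cong₂ (λ x y → x + a * y) (eq i<j) (δ-≢ i≢j))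
  (trans (cong (a + H i j +_) (*-zeroʳ a)) (+-identityʳ _))
... | tri> _ i≢j j<i =
  trans (cong₂ (λ x y → x + a * y) (trans (sym-W i j) (trans (eq j<i) (cong (a +_) (sym-H j i)))) (δ-≢ i≢j))
  (trans (cong (a + H i j +_) (*-zeroʳ a)) (+-identityʳ _))
... | tri≈ _ refl _ = trans (cong₂ (λ x y → x + a * y) (loopless-W i) (δ-refl i))
  (trans (*-identityʳ a) (trans (sym (+-identityʳ a)) (cong (a +_) (sym (loopless-H i)))))

InT-offset : ∀ {r a n} {w : Multigraph n} ((f , _) : InT r 0 a n w) → Offset a (symmetrise w) (cross f)
InT-offset {a = a} {w = w} (f , eq) =
  offset-offDiagonal {a} (symmetrise-symm w) (cross-symm f) (symmetrise-loopless w) (cross-loopless f)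
  λ {i} {j} i<j → trans (symmetrise-< w i<j) (trans (eq i j i<j) (partMult-cross a f i j))

InT-near : ∀ {r a n} {w : Multigraph n} → InT r 0 a n w → ∀ {i j} → i F.< j → Near a (w i j)
InT-near {a = a} (f , eq) {i} {j} i<j with f i F.≟ f j
... | yes e = inj₁ (trans (eq i j i<j) (partMult-≡ a e))
... | no ne = inj₂ (trans (eq i j i<j) (partMult-≢ a ne))

partGraph : ∀ {r n} → ℕ → (Fin n → Fin r) → Multigraph n
partGraph a f i j = partMult 0 a (f i) (f j)

partGraph-InT : ∀ {r n} a (f : Fin n → Fin r) → InT r 0 a n (partGraph a f)
partGraph-InT a f = f , λ _ _ _ → refl

-- Relabelled along `elements X`, the restriction to `X` belongs to the same family on `∣ X ∣`
-- points, where `q` is an upper bound.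
InT-edgesIn : ∀ {r a n q} {w : Multigraph n} → InT r 0 a n w → (X : Subset n) →
              (∀ v → InT r 0 a ∣ X ∣ v → edges v ≤ q) → edgesIn w X ≤ q
InT-edgesIn {a = a} {q = q} {w} t@(f , _) X maximal = subst (_≤ q) (*-cancelˡ-≡ _ _ 2 (begin
  2 * edges v                   ≡⟨ 2*edges≡total v ⟩
  total (symmetrise v)          ≡⟨ +-cancelʳ-≡ (a * ∣ X ∣) _ _ (trans total-v (sym total-w)) ⟩
  total (symmetrise w on c)     ≡⟨ sym (2*edgesIn≡total {c = c} {X} (elements-enumerates X) w) ⟩
  2 * edgesIn w X ∎)) (maximal v t′)
  where
  open ≡-Reasoning
  c = elements X
  v = partGraph a (f ∘ c)
  t′ = partGraph-InT a (f ∘ c)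
  total-v : total (symmetrise v) + a * ∣ X ∣ ≡ a * ∣ X ∣ * ∣ X ∣ + total (cross (f ∘ c))
  total-v = offset-total {a} (InT-offset {w = v} t′)
  total-w : total (symmetrise w on c) + a * ∣ X ∣ ≡ a * ∣ X ∣ * ∣ X ∣ + total (cross (f ∘ c))
  total-w = offset-total {a} (offset-on {a} {W = symmetrise w} {cross f} {c} (elements-injective X) (InT-offset {w = w} t))

-- Turán numbers and averaging.

module Turán (r : ℕ) .{{_ : NonZero r}} where

  -- The number of pairs inside the parts of the balanced r-partition of m points.
  missing : ℕ → ℕ
  missing zero    = 0
  missing (suc m) = missing m + m / r

  quotient : ∀ k {i} → i < r → (i + k * r) / r ≡ k
  quotient k {i} i<r = trans (+-distrib-/-∣ʳ i (n∣m*n k)) (cong₂ _+_ (m<n⇒m/n≡0 i<r) (m*n/n≡m k r))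

  -- On i + k r points, i parts have size k + 1 and r - i have size k. Admitting i = r lets the
  -- induction pass from (k, r) to (k + 1, 0).
  missing-closed : ∀ k i → i ≤ r → 2 * missing (i + k * r) + k * r ≡ k * (2 * i + k * r)
  missing-closed zero    zero    _ = refl
  missing-closed (suc k) zero    _ = trans (step₁ (missing (r + k * r)) r (k * r))
    (trans (cong (r +_) (missing-closed k r ≤-refl)) (step₂ k r))
    where
    step₁ : ∀ M r q → 2 * M + (r + q) ≡ r + (2 * M + q)
    step₁ = solve-∀
    step₂ : ∀ k r → r + k * (2 * r + k * r) ≡ suc k * (r + k * r)
    step₂ = solve-∀
  missing-closed k (suc i) i<r rewrite quotient k i<r =
    trans (step₁ (missing (i + k * r)) k (k * r))
      (trans (cong (2 * k +_) (missing-closed k i (<⇒≤ i<r))) (step₂ k i (k * r)))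
    where
    step₁ : ∀ M k q → 2 * (M + k) + q ≡ 2 * k + (2 * M + q)
    step₁ = solve-∀
    step₂ : ∀ k i q → 2 * k + k * (2 * i + q) ≡ k * (2 * suc i + q)
    step₂ = solve-∀

  missing-closed′ : ∀ m → 2 * missing m + m / r * r ≡ m / r * (2 * (m % r) + m / r * r)
  missing-closed′ m = subst (λ x → 2 * missing x + m / r * r ≡ m / r * (2 * (m % r) + m / r * r))
    (sym (m≡m%n+[m/n]*n m r)) (missing-closed (m / r) (m % r) (<⇒≤ (m%n<n m r)))

  -- The numeric condition for rounding. With `suc m` = i + k r the closed formula reduces it to 2 ≤
  -- k i + k + i, which fails only when `suc m` is 1 or `r`.
  missing-large : ∀ m → r < suc m → m * (suc m / r) < 2 * missing (suc m) + m
  missing-large m r<m = +-cancelʳ-≤ (suc (k + k * r)) _ _ (begin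
    suc (m * k) + suc (k + k * r)                    ≡⟨ shape₁ m k r ⟩
    2 + (suc m * k + k * r)                          ≤⟨ +-monoˡ-≤ _ (lower k i suc-m≡ (m%n<n (suc m) r)) ⟩
    (k * i + k + i) + (suc m * k + k * r)            ≡⟨ cong (λ x → (k * i + k + i) + (x * k + k * r)) suc-m≡ ⟩
    (k * i + k + i) + ((i + k * r) * k + k * r)      ≡⟨ shape₂ i k r ⟩
    k * (2 * i + k * r) + k + (i + k * r)            ≡⟨ cong₂ (λ x y → x + k + y) (sym (missing-closed′ (suc m))) (sym suc-m≡) ⟩
    (2 * missing (suc m) + k * r) + k + suc m        ≡⟨ shape₃ (2 * missing (suc m)) m k r ⟩
    2 * missing (suc m) + m + suc (k + k * r) ∎)
    where
    open ≤-Reasoning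
    k = suc m / r
    i = suc m % r
    suc-m≡ : suc m ≡ i + k * r
    suc-m≡ = m≡m%n+[m/n]*n (suc m) r
    shape₁ : ∀ m k r → suc (m * k) + suc (k + k * r) ≡ 2 + (suc m * k + k * r)
    shape₁ = solve-∀
    shape₂ : ∀ i k r → (k * i + k + i) + ((i + k * r) * k + k * r) ≡ k * (2 * i + k * r) + k + (i + k * r)
    shape₂ = solve-∀
    shape₃ : ∀ h m k r → (h + k * r) + k + suc m ≡ h + m + suc (k + k * r)
    shape₃ = solve-∀
    lower : ∀ k i → suc m ≡ i + k * r → i < r → 2 ≤ k * i + k + i
    lower zero i e i<r = contradiction (subst (r <_) (trans e (+-identityʳ i)) r<m) (<-asym i<r)
    lower (suc zero) zero e i<r = contradiction (sym (trans e (+-identityʳ r))) (<⇒≢ r<m)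
    lower (suc zero) (suc i) e i<r = ≤-trans (s≤s (s≤s z≤n)) (≤-reflexive (sym (lem i)))
      where
      lem : ∀ i → 1 * suc i + 1 + suc i ≡ 2 + (1 + 2 * i)
      lem = solve-∀
    lower (suc (suc k)) i e i<r = ≤-trans (m≤n+m 2 _) (≤-reflexive (lem k i))
      where
      lem : ∀ k i → ((2 + k) * i + k + i) + 2 ≡ (2 + k) * i + (2 + k) + i
      lem = solve-∀

  -- e(W) ≤ (b - 1) C(m,2) + t_r(m), doubled and without subtraction.
  Bounded : ℕ → ∀ {m} → Multigraph m → Set
  Bounded b {m} W = total W + 2 * missing m + b * m ≤ b * m * m

  -- Serves with b = a + 1 for multigraphs, and with b = 1 as the induction step of Turán's theorem.
  averaging : ∀ {b m} {W : Multigraph (suc m)} → r < m → Symm W → Loopless W →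
              (∀ k → Bounded b (W on punchIn k)) → Bounded b W
  averaging {b} {suc m} {W} r<m sym-W loopless bounded
    rewrite total-even sym-W loopless =
    averaging-arithmetic m b (missing (suc m)) (suc m / r) (edges W) (∑ (λ k → total (W on punchIn k)))
      (missing-large m r<m) summed
      (subst (λ t → suc (suc m) * t ≡ 2 * t + ∑ (λ k → total (W on punchIn k))) (total-even sym-W loopless)
        (total-average sym-W loopless))
    where
    c = 2 * missing (suc m) + b * suc m
    summed : ∑ (λ k → total (W on punchIn k)) + suc (suc m) * c ≤ suc (suc m) * (b * suc m * suc m)
    summed = begin
      ∑ (λ k → total (W on punchIn k)) + suc (suc m) * c
        ≡⟨ cong (∑ (λ k → total (W on punchIn k)) +_) (sym (∑-const (suc (suc m)) c)) ⟩
      ∑ (λ k → total (W on punchIn k)) + ∑ {suc (suc m)} (λ _ → c)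
        ≡⟨ sym (∑-distrib-+ (λ k → total (W on punchIn k)) (λ _ → c)) ⟩
      ∑ (λ k → total (W on punchIn k) + c)
        ≤⟨ ∑-mono-≤ (λ k → ≤-trans (≤-reflexive (sym (+-assoc (total (W on punchIn k)) _ _))) (bounded k)) ⟩
      ∑ {suc (suc m)} (λ _ → b * suc m * suc m)
        ≡⟨ ∑-const (suc (suc m)) (b * suc m * suc m) ⟩
      suc (suc m) * (b * suc m * suc m) ∎
      where open ≤-Reasoning

  -- Injective tuples stand for sets, so that deleting and adding a vertex become `punchIn` and `◂`.
  BoundedTuples : ℕ → ℕ → ∀ {n} → Multigraph n → Set
  BoundedTuples b m {n} W = (c : Fin m → Fin n) → Inj c → Bounded b (W on c)

  boundedTuples-up : ∀ {b m m′ n} {W : Multigraph n} → Symm W → Loopless W → r < m → m ≤ m′ →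
                     BoundedTuples b m W → BoundedTuples b m′ W
  boundedTuples-up {m′ = zero} sym-W loopless r<m z≤n bounded = bounded
  boundedTuples-up {b} {m} {suc m′} {W = W} sym-W loopless r<m m≤m′ bounded with m≤n⇒m<n∨m≡n m≤m′
  ... | inj₂ refl       = bounded
  ... | inj₁ (s≤s m≤m″) = λ c c-inj →
    averaging {b} {m′} {W on c} (<-≤-trans r<m m≤m″) (λ i j → sym-W (c i) (c j)) (λ i → loopless (c i)) λ k →
      boundedTuples-up {b} sym-W loopless r<m m≤m″ bounded (c ∘ punchIn k) (λ e → F.punchIn-injective k _ _ (c-inj e))

  CliqueFree : ∀ {n} → Multigraph n → Set
  CliqueFree {n} W = (c : Fin (suc r) → Fin n) → ∃₂ λ i j → i ≢ j × W (c i) (c j) ≡ 0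

  missing-r : missing r ≡ 0
  missing-r = *-cancelˡ-≡ _ 0 2 (trans (cong (λ x → 2 * missing x) (sym (+-identityʳ r)))
    (trans (sym (+-identityʳ _)) (missing-closed 0 r ≤-refl)))

  missing-1+r : missing (suc r) ≡ 1
  missing-1+r = cong₂ _+_ missing-r (n/n≡1 r)

  turán-base : ∀ {W : Multigraph (suc r)} → Symm W → Loopless W → Simple W → CliqueFree W → Bounded 1 W
  turán-base {W} sym-W loopless simple free with free id
  ... | i , j , i≢j , Wij≡0 = subst₂ _≤_
    (sym (cong₂ (λ x y → total W + 2 * x + y) missing-1+r (*-identityˡ (suc r))))
    (sym (cong (_* suc r) (*-identityˡ (suc r))))
    (total-nonedge sym-W loopless simple i≢j Wij≡0)

  -- At `r + 1` points a single nonedge is the whole bound, and from there on `averaging` suffices.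
  turán : ∀ {n} {W : Multigraph n} → r < n → Symm W → Loopless W → Simple W → CliqueFree W → Bounded 1 W
  turán {suc n} {W} r<1+n sym-W loopless simple free with m≤n⇒m<n∨m≡n (s≤s⁻¹ r<1+n)
  ... | inj₁ r<n = averaging {1} r<n sym-W loopless λ k →
    turán r<n (λ i j → sym-W (punchIn k i) (punchIn k j)) (λ i → loopless (punchIn k i))
      (λ i j → simple (punchIn k i) (punchIn k j)) (λ c → free (punchIn k ∘ c))
  ... | inj₂ refl = turán-base sym-W loopless simple free

  -- Zykov symmetrisation of extremal graphs.

  Tight : ∀ {n} → Multigraph n → Set
  Tight {n} W = 1 * n * n ≤ total W + 2 * missing n + 1 * n

  -- Zykov symmetrisation: W on replace y x makes y a twin of x, and pulling back along any map keeps W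
  -- clique-free.
  module _ {n} (r<n : r < n) where

    -- If `x` had the larger degree, turning `y` into a twin of `x` would exceed the Turán bound,
    -- which `W` already attains.
    degree-≤ : ∀ {W : Multigraph n} → Symm W → Loopless W → Simple W → CliqueFree W → Tight W →
               ∀ {x y} → W x y ≡ 0 → degree W x ≤ degree W y
    degree-≤ {W} sym-W loopless simple free tight {x} {y} Wxy≡0 =
      *-cancelˡ-≤ 2 (+-cancelˡ-≤ (total W) _ _ (begin
        total W + 2 * degree W x                     ≡⟨ sym (total-replace sym-W loopless Wxy≡0) ⟩
        total (W on ρ) + 2 * degree W y              ≤⟨ +-monoˡ-≤ (2 * degree W y) shrink ⟩
        total W + 2 * degree W y ∎))
      where
      open ≤-Reasoning
      ρ = replace y x
      bounded : Bounded 1 (W on ρ)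
      bounded = turán r<n (λ i j → sym-W (ρ i) (ρ j)) (λ i → loopless (ρ i))
        (λ i j → simple (ρ i) (ρ j)) (λ c → free (ρ ∘ c))
      shrink : total (W on ρ) ≤ total W
      shrink = +-cancelʳ-≤ (2 * missing n) _ _ (+-cancelʳ-≤ (1 * n) _ _ (≤-trans bounded tight))

    degree-≡ : ∀ {W : Multigraph n} → Symm W → Loopless W → Simple W → CliqueFree W → Tight W →
               ∀ {x y} → W x y ≡ 0 → degree W x ≡ degree W y
    degree-≡ sym-W loopless simple free tight {x} {y} Wxy≡0 =
      ≤-antisym (degree-≤ sym-W loopless simple free tight Wxy≡0)
                (degree-≤ sym-W loopless simple free tight (trans (sym-W y x) Wxy≡0))

    -- Suppose `x` and `z` are adjacent, and turn `x` into a twin of `y`. Since `x` and `y` have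
    -- equal degrees, the new graph `V` is still extremal, so the nonadjacent `y` and `z` have equal
    -- degrees in `V` as well as in `W`. But `z` has lost its edge to `x`, while the degree of `y`
    -- is unchanged.
    nonadjacent-trans : ∀ {W : Multigraph n} → Symm W → Loopless W → Simple W → CliqueFree W → Tight W →
                        ∀ x y z → W x y ≡ 0 → W y z ≡ 0 → W x z ≡ 0
    nonadjacent-trans {W} sym-W loopless simple free tight x y z Wxy≡0 Wyz≡0 with W x z in Wxz
    ... | zero  = refl
    ... | suc k = contradiction degrees (m+1+n≢m (degree W y))
      where
      z≢x : z ≢ x
      z≢x refl = 1+n≢0 (trans (sym Wxz) (loopless x))
      y≢x : y ≢ x
      y≢x refl = 1+n≢0 (trans (sym Wxz) Wyz≡0)
      ρ = replace x y
      V = W on ρ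
      V-degree : ∀ {u} → u ≢ x → degree V u + W u x ≡ degree W u + W u y
      V-degree {u} u≢x = subst (λ t → ∑ (W t ∘ ρ) + W u x ≡ degree W u + W u y) (sym (replace-miss u≢x))
        (∑-replace x y (W u))
      V-total : total V ≡ total W
      V-total = +-cancelʳ-≡ (2 * degree W x) _ _ (trans (total-replace sym-W loopless (trans (sym-W y x) Wxy≡0))
        (cong (λ d → total W + 2 * d) (sym (degree-≡ sym-W loopless simple free tight Wxy≡0))))
      V-yz : V y z ≡ 0
      V-yz = trans (cong₂ W (replace-miss y≢x) (replace-miss z≢x)) Wyz≡0
      V-degrees : degree V y ≡ degree V z
      V-degrees = degree-≡ {V} (λ i j → sym-W (ρ i) (ρ j)) (λ i → loopless (ρ i)) (λ i j → simple (ρ i) (ρ j))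
        (λ c → free (ρ ∘ c)) (subst (λ t → 1 * n * n ≤ t + 2 * missing n + 1 * n) (sym V-total) tight) {y} {z} V-yz
      degrees : degree W y + suc k ≡ degree W y
      degrees = begin
        degree W y + suc k      ≡⟨ cong₂ _+_ (sym (+-identityʳ _)) (trans (sym Wxz) (sym-W x z)) ⟩
        degree W y + 0 + W z x  ≡⟨ cong (λ t → degree W y + t + W z x) (sym (loopless y)) ⟩
        degree W y + W y y + W z x ≡⟨ cong (_+ W z x) (sym (V-degree y≢x)) ⟩
        degree V y + W y x + W z x ≡⟨ cong (λ t → degree V y + t + W z x) (trans (sym-W y x) Wxy≡0) ⟩
        degree V y + 0 + W z x  ≡⟨ cong (_+ W z x) (trans (+-identityʳ _) V-degrees) ⟩
        degree V z + W z x      ≡⟨ V-degree z≢x ⟩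
        degree W z + W z y      ≡⟨ cong (degree W z +_) (trans (sym-W z y) Wyz≡0) ⟩
        degree W z + 0          ≡⟨ +-identityʳ _ ⟩
        degree W z              ≡⟨ sym (degree-≡ sym-W loopless simple free tight Wyz≡0) ⟩
        degree W y ∎
        where open ≡-Reasoning

  -- Descent to small sets by the minimum degree.

  growth-contradiction : ∀ m y e K D → let n = m + 2 + y; Q = 2 * e + 2 * missing m + 2 * (m / r); U = m * m + m in
    r ≤ m → r * m ≤ y →
    n * Q + 2 * D + m * U ≤ (m * Q + 2 * (2 * e)) + n * U →
    m * m + 2 ≤ 2 * e + 2 * missing m + m →
    m * n ≤ D + m * (1 + K) →
    ¬ (1 + K * r ≤ n)
  growth-contradiction m y e K D r≤m rm≤y outside excess degrees K-bound =
    growth-impossible i j z (missing m) k closed (m≥n⇒m/n>0 r≤m) le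
    where
    k = m / r
    i = m % r
    j = r ∸ suc i
    z = y ∸ r * m
    r≡ : r ≡ i + suc j
    r≡ = trans (sym (m+[n∸m]≡n (m%n<n m r))) (sym (+-suc i j))
    m≡ : m ≡ i + k * r
    m≡ = m≡m%n+[m/n]*n m r
    closed : 2 * missing m + k * (i + suc j) ≡ k * (2 * i + k * (i + suc j))
    closed = subst (λ r′ → 2 * missing m + k * r′ ≡ k * (2 * i + k * r′)) r≡ (missing-closed′ m)
    m≡′ : m ≡ i + k * (i + suc j)
    m≡′ = trans m≡ (cong (λ r′ → i + k * r′) r≡)
    Claim : ℕ → ℕ → ℕ → Set
    Claim r′ m′ y′ = r′ * (y′ * (1 + k) + 2 * missing m + 2 * k) + m′ ≤ m′ * (m′ + 2 + y′)
    le : Claim (i + suc j) (i + k * (i + suc j)) ((i + suc j) * (i + k * (i + suc j)) + z)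
    le = subst₂ (λ r′ m′ → Claim r′ m′ (r′ * m′ + z)) r≡ m≡′
      (subst (Claim r m) (sym (m+[n∸m]≡n rm≤y))
        (growth-arithmetic m y e (missing m) k K D r outside excess degrees K-bound))

  -- Every extension of an overfull `c` by one vertex obeys the bound, so each outside vertex has at
  -- most m - 1 - m / r neighbours in `c`. The degree sum over `c` is then smaller than the minimum
  -- degree allows.
  boundedTuples-down : ∀ {n m} {H : Multigraph (suc n)} → Symm H → Loopless H →
    (∀ v → suc n ≤ degree H v + suc (n / r)) → r ≤ m → r * m + (m + 2) ≤ suc n →
    BoundedTuples 1 (suc m) H → BoundedTuples 1 m H
  boundedTuples-down {n} {zero} {H} sym-H loopless min-degree r≤m large bounded c c-inj = z≤n
  boundedTuples-down {n} {m@(suc m′)} {H} sym-H loopless min-degree r≤m large bounded c c-inj = ≮⇒≥ λ over →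
    growth-contradiction m y e K D r≤m (≤-trans (≤-reflexive (sym (m+n∸n≡m (r * m) (m + 2)))) (∸-monoˡ-≤ (m + 2) large))
      (subst (λ n′ → n′ * Q + 2 * D + m * U ≤ (m * Q + 2 * (2 * e)) + n′ * U) (sym n≡) outside)
      (excess over)
      (subst (λ n′ → m * n′ ≤ D + m * (1 + K)) (sym n≡) degrees)
      (subst (1 + K * r ≤_) (sym n≡) (s≤s (m/n*n≤m n r)))
    where
    K = n / r
    e = edges (H on c)
    y = suc n ∸ (m + 2)
    D = ∑ (degree H ∘ c)
    Q = 2 * e + 2 * missing m + 2 * (m / r)
    U = m * m + m
    n≡ : m + 2 + y ≡ suc n
    n≡ = m+[n∸m]≡n (≤-trans (m≤n+m (m + 2) (r * m)) large)
    total≡ : total (H on c) ≡ 2 * e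
    total≡ = total-even (λ i j → sym-H (c i) (c j)) (λ i → loopless (c i))

    excess : 1 * m * m < total (H on c) + 2 * missing m + 1 * m → m * m + 2 ≤ 2 * e + 2 * missing m + m
    excess over = subst₂ _≤_ (trans (shift (2 * C) m) (cong (_+ 2) (sym square)))
      (cong (_+ m) (*-distribˡ-+ 2 e (missing m)))
      (+-monoˡ-≤ m (even-gap {C} {e + missing m} (+-cancelʳ-< m _ _
        (subst₂ _<_ (trans (cong (_* m) (*-identityˡ m)) square)
          (cong₂ _+_ (trans (cong (_+ 2 * missing m) total≡) (sym (*-distribˡ-+ 2 e (missing m)))) (*-identityˡ m)) over))))
      where
      C = proj₁ (consecutive-even m′)
      square : m * m ≡ 2 * C + m
      square = trans (lem m′) (cong (_+ m) (proj₂ (consecutive-even m′)))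
        where
        lem : ∀ m′ → suc m′ * suc m′ ≡ m′ * suc m′ + suc m′
        lem = solve-∀
      shift : ∀ x m → x + 2 + m ≡ x + m + 2
      shift = solve-∀

    degrees : m * suc n ≤ D + m * (1 + K)
    degrees = begin
      m * suc n                               ≡⟨ sym (∑-const m (suc n)) ⟩
      ∑ {m} (λ _ → suc n)                     ≤⟨ ∑-mono-≤ (λ k → min-degree (c k)) ⟩
      ∑ (λ k → degree H (c k) + suc K)        ≡⟨ ∑-distrib-+ (degree H ∘ c) (λ _ → suc K) ⟩
      D + ∑ {m} (λ _ → suc K)                 ≡⟨ cong (D +_) (∑-const m (suc K)) ⟩
      D + m * suc K ∎
      where open ≤-Reasoning

    d : Fin (suc n) → ℕ
    d v = ∑ (H v ∘ c)

    extension : ∀ v → (∀ k → c k ≢ v) → Q + 2 * d v ≤ U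
    extension v v∉c = +-cancelʳ-≤ (1 + m) _ _ (subst₂ _≤_ lhs (square m) (bounded (v ◂ c) inj))
      where
      inj : Inj (v ◂ c)
      inj {zero}  {zero}  _ = refl
      inj {zero}  {suc k} p = contradiction (sym p) (v∉c k)
      inj {suc k} {zero}  p = contradiction p (v∉c k)
      inj {suc k} {suc l} p = cong suc (c-inj p)
      square : ∀ m → 1 * suc m * suc m ≡ m * m + m + (1 + m)
      square = solve-∀
      shape : ∀ d t h k m → 2 * d + t + 2 * (h + k) + 1 * suc m ≡ t + 2 * h + 2 * k + 2 * d + (1 + m)
      shape = solve-∀
      lhs : total (H on (v ◂ c)) + 2 * missing (suc m) + 1 * suc m ≡ Q + 2 * d v + (1 + m)
      lhs = trans (cong (λ t → t + 2 * missing (suc m) + 1 * suc m)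
          (trans (total-remove {W = H on (v ◂ c)} (λ i j → sym-H ((v ◂ c) i) ((v ◂ c) j)) (λ i → loopless ((v ◂ c) i)) zero)
            (cong₂ (λ x t → 2 * (x + d v) + t) (loopless v) total≡)))
        (shape (d v) (2 * e) (missing m) (m / r) m)

    outside : suc n * Q + 2 * D + m * U ≤ (m * Q + 2 * (2 * e)) + suc n * U
    outside = subst₂ (λ x y → x + m * U ≤ y + suc n * U) all-v over-c
      (∑-outside-≤ c-inj (λ v → Q + 2 * d v) U extension)
      where
      linear : ∀ {l} (g : Fin l → Fin (suc n)) → ∑ (λ v → Q + 2 * d (g v)) ≡ l * Q + 2 * ∑ (d ∘ g)
      linear {l} g = trans (∑-distrib-+ (λ _ → Q) (λ v → 2 * d (g v)))
        (cong₂ _+_ (∑-const l Q) (sym (*-distribˡ-sum 2 (d ∘ g))))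
      all-v : ∑ (λ v → Q + 2 * d v) ≡ suc n * Q + 2 * D
      all-v = trans (linear id) (cong (λ x → suc n * Q + 2 * x)
        (trans (∑-comm (λ v k → H v (c k))) (sum-cong-≗ (λ k → sum-cong-≗ (λ v → sym-H v (c k))))))
      over-c : ∑ (λ k → Q + 2 * d (c k)) ≡ m * Q + 2 * (2 * e)
      over-c = trans (linear c) (cong (λ x → m * Q + 2 * x) total≡)

  boundedTuples-descend : ∀ {n} d {m} {H : Multigraph (suc n)} → Symm H → Loopless H →
    (∀ v → suc n ≤ degree H v + suc (n / r)) → r < m → r * (d + m) + (d + m + 2) ≤ suc n →
    BoundedTuples 1 (d + m) H → BoundedTuples 1 m H
  boundedTuples-descend zero    sym-H loopless min-degree r<m large bounded = bounded
  boundedTuples-descend {n} (suc d) {m} {H} sym-H loopless min-degree r<m large bounded =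
    boundedTuples-down sym-H loopless min-degree (<⇒≤ r<m)
      (≤-trans (+-mono-≤ (*-monoʳ-≤ r (m≤n+m m (suc d))) (+-monoˡ-≤ 2 (m≤n+m m (suc d)))) large)
      (boundedTuples-descend d sym-H loopless min-degree (m<n⇒m<1+n r<m)
        (subst (λ x → r * x + (x + 2) ≤ suc n) (sym (+-suc d m)) large)
        (subst (λ x → BoundedTuples 1 x H) (sym (+-suc d m)) bounded))

  -- On `r + 1` points the bound is one edge short of complete. Adding `δ` keeps i = j out of the
  -- search; if the search fails, looplessness makes `c` injective, and the bound is violated.
  cliqueFree : ∀ {n} {H : Multigraph n} → Loopless H → BoundedTuples 1 (suc r) H → CliqueFree H
  cliqueFree {n} {H} loopless bounded c with F.any? (λ i → F.any? (λ j → (H (c i) (c j) + δ i j) ≟ 0))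
  ... | yes (i , j , e) =
    i , j , (λ { refl → 1+n≢0 (trans (sym (δ-refl i)) (m+n≡0⇒n≡0 (H (c i) (c i)) e)) }) , m+n≡0⇒m≡0 _ e
  ... | no clique = contradiction (≤-trans (s≤s (≤-trans tight (+-monoˡ-≤ (suc r) (m≤m+n T 1)))) strict) (<-irrefl refl)
    where
    T = total (H on c)
    adjacent : ∀ i j → 1 ≤ H (c i) (c j) + δ i j
    adjacent i j = n≢0⇒n>0 (λ e → clique (i , j , e))
    c-inj : Inj c
    c-inj {i} {j} ci≡cj with i F.≟ j
    ... | yes i≡j = i≡j
    ... | no i≢j = contradiction (i , j , cong₂ _+_ (trans (cong (H (c i)) (sym ci≡cj)) (loopless (c i))) (δ-≢ i≢j)) clique
    tight : suc r * suc r ≤ T + suc r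
    tight = subst₂ _≤_ (total-1 (suc r))
      (trans (total-+ (H on c) (δ {suc r})) (cong (T +_) (total-δ (suc r)))) (total-mono adjacent)
    strict : suc (T + 1 + suc r) ≤ suc r * suc r
    strict = subst₂ _≤_ (trans (cong₂ (λ h x → T + 2 * h + x) missing-1+r (*-identityˡ (suc r))) (shape T (suc r)))
      (cong (_* suc r) (*-identityˡ (suc r))) (bounded c c-inj)
      where
      shape : ∀ T x → T + 2 * 1 + x ≡ suc (T + 1 + x)
      shape = solve-∀

  -- Deleting `v` leaves at most t_r(n) edges, so its degree is at least t_r(n+1) - t_r(n) = n - n /
  -- r.
  min-degree : ∀ {n} {H : Multigraph (suc n)} → Symm H → Loopless H → Tight H → BoundedTuples 1 n H →
               ∀ v → suc n ≤ degree H v + suc (n / r)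
  min-degree {n} {H} sym-H loopless tight bounded v = subst (suc n ≤_) (sym (+-suc (degree H v) (n / r)))
    (s≤s (*-cancelˡ-≤ 2 (+-cancelʳ-≤ (1 + n + n * n + T + 2 * missing n) _ _
      (subst₂ _≤_ (left n T (missing n)) (trans (cong (λ t → t + 2 * missing (suc n) + 1 * suc n + 1 * n * n)
          (total-remove sym-H loopless v)) (right n T (missing n) (degree H v) (n / r)))
        (+-mono-≤ tight (bounded (punchIn v) (F.punchIn-injective v _ _)))))))
    where
    T = total (H on punchIn v)
    left : ∀ n T h → 1 * suc n * suc n + (T + 2 * h + 1 * n) ≡ 2 * n + (1 + n + n * n + T + 2 * h)
    left = solve-∀
    right : ∀ n T h d k → 2 * d + T + 2 * (h + k) + 1 * suc n + 1 * n * n ≡ 2 * (d + k) + (1 + n + n * n + T + 2 * h)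
    right = solve-∀

  -- The balanced partition.

  cross-cliqueFree : ∀ {n} (f : Fin n → Fin r) → CliqueFree (cross f)
  cross-cliqueFree f c with F.pigeonhole (n<1+n r) (f ∘ c)
  ... | i , j , i<j , e = i , j , (λ i≡j → F.<⇒≢ i<j i≡j) ,
    trans (cong (λ x → 1 ∸ δ (f (c i)) x) (sym e)) (cong (1 ∸_) (δ-refl (f (c i))))

  smallPart : ∀ {n} (f : Fin n → Fin r) → ∃ λ x → fibre f x ≤ n / r
  smallPart {n} f with F.any? (λ x → fibre f x ≤? n / r)
  ... | yes small = small
  ... | no none = contradiction (≤-trans (≤-reflexive (sym (∑-const r (suc (n / r)))))
      (≤-trans (∑-mono-≤ (λ x → ≰⇒> (λ le → none (x , le)))) (≤-reflexive (∑-fibre-1 f)))) (<⇒≱ n<)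
    where
    n< : n < r * suc (n / r)
    n< = subst₂ _<_ (sym (m≡m%n+[m/n]*n n r)) (trans (cong (r +_) (*-comm (n / r) r)) (sym (*-suc r (n / r))))
      (+-monoˡ-< (n / r * r) (m%n<n n r))

  -- Greedy construction: each new vertex joins a part of size at most `n / r`, so it creates no
  -- more inner pairs than the recursion of `missing` permits.
  turánPartition : ∀ n → Σ (Fin n → Fin r) λ f → Tight (cross f)
  turánPartition zero = (λ ()) , z≤n
  turánPartition (suc n) with turánPartition n
  ... | f , tight with smallPart f
  ... | x , small = x ◂ f , ≤-trans (≤-reflexive (left n)) (≤-trans (+-mono-≤ tight (s≤s (*-monoʳ-≤ 2 n≤)))
      (≤-reflexive (trans (right d (total (cross f)) (missing n) (n / r) n)
        (cong (λ t → t + 2 * missing (suc n) + 1 * suc n) (sym split)))))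
    where
    d = degree (cross (x ◂ f)) zero
    d≡ : d ≡ ∑ (λ j → 1 ∸ δ x (f j))
    d≡ = cong (_+ ∑ (λ j → 1 ∸ δ x (f j))) (cong (1 ∸_) (δ-refl x))
    split : total (cross (x ◂ f)) ≡ 2 * d + total (cross f)
    split = total-remove (cross-symm (x ◂ f)) (cross-loopless (x ◂ f)) zero
    complementary : ∀ j → 1 ≡ (1 ∸ δ x (f j)) + δ (f j) x
    complementary j = sym (trans (cong (1 ∸ δ x (f j) +_) (δ-symm (f j) x)) (m∸n+n≡m (δ≤1 x (f j))))
    n≡ : n ≡ d + fibre f x
    n≡ = begin
      n                                                  ≡⟨ sym (trans (∑-const n 1) (*-identityʳ n)) ⟩
      ∑ {n} (λ _ → 1)                                    ≡⟨ sum-cong-≗ complementary ⟩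
      ∑ (λ j → (1 ∸ δ x (f j)) + δ (f j) x)              ≡⟨ ∑-distrib-+ (λ j → 1 ∸ δ x (f j)) (λ j → δ (f j) x) ⟩
      ∑ (λ j → 1 ∸ δ x (f j)) + fibre f x                ≡⟨ cong (_+ fibre f x) (sym d≡) ⟩
      d + fibre f x ∎
      where open ≡-Reasoning
    n≤ : n ≤ d + n / r
    n≤ = ≤-trans (≤-reflexive n≡) (+-monoʳ-≤ d small)
    left : ∀ n → 1 * suc n * suc n ≡ 1 * n * n + suc (2 * n)
    left = solve-∀
    right : ∀ d t h k n → t + 2 * h + 1 * n + suc (2 * (d + k)) ≡ 2 * d + t + 2 * (h + k) + 1 * suc n
    right = solve-∀

  -- Transfer between multigraphs and graphs, and the extremal comparison.

  module _ {a n} {W H : Multigraph n} (offset : Offset a W H) where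

    private
      left : ∀ T a n h → T + 2 * h + suc a * n ≡ T + a * n + (2 * h + 1 * n)
      left = solve-∀
      right : ∀ T a n h → a * n * n + T + (2 * h + 1 * n) ≡ a * n * n + (T + 2 * h + 1 * n)
      right = solve-∀
      square : ∀ a n → suc a * n * n ≡ a * n * n + 1 * n * n
      square = solve-∀
      transfer : total W + 2 * missing n + suc a * n ≡ a * n * n + (total H + 2 * missing n + 1 * n)
      transfer = trans (left (total W) a n (missing n))
        (trans (cong (_+ (2 * missing n + 1 * n)) (offset-total {a} offset)) (right (total H) a n (missing n)))

    offset-bounded⁻ : Bounded (suc a) W → Bounded 1 H
    offset-bounded⁻ bounded = +-cancelˡ-≤ (a * n * n) _ _ (subst₂ _≤_ transfer (square a n) bounded)

    offset-bounded⁺ : Bounded 1 H → Bounded (suc a) W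
    offset-bounded⁺ bounded = subst₂ _≤_ (sym transfer) (sym (square a n)) (+-monoʳ-≤ (a * n * n) bounded)

    offset-tight⁺ : Tight H → suc a * n * n ≤ total W + 2 * missing n + suc a * n
    offset-tight⁺ tight = subst₂ _≤_ (sym (square a n)) (sym transfer) (+-monoʳ-≤ (a * n * n) tight)

    offset-tight⁻ : suc a * n * n ≤ total W + 2 * missing n + suc a * n → Tight H
    offset-tight⁻ tight = +-cancelˡ-≤ (a * n * n) _ _ (subst₂ _≤_ (square a n) transfer tight)

  -- The bound on s-sets travels both ways: up to n-sets for the minimum degree, and then down to
  -- (r+1)-sets for the absence of cliques.
  tight⇒partition : ∀ {n s} {H : Multigraph (suc n)} → Symm H → Loopless H → Simple H → r < s → s ≤ n →
    r * s + (s + 2) ≤ suc n → BoundedTuples 1 s H → Tight H →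
    Σ (Fin (suc n) → Fin r) λ f → ∀ i j → (f i ≡ f j → H i j ≡ 0) × (H i j ≡ 0 → f i ≡ f j)
  tight⇒partition {n} {s} {H} sym-H loopless simple r<s s≤n large bounded tight =
    colouring (suc n) r H loopless sym-H
      (nonadjacent-trans (<-≤-trans r<s (m≤n⇒m≤1+n s≤n)) sym-H loopless simple free tight) free
    where
    s≡ : s ∸ suc r + suc r ≡ s
    s≡ = m∸n+n≡m r<s
    free : CliqueFree H
    free = cliqueFree {H = H} loopless (boundedTuples-descend (s ∸ suc r) {H = H} sym-H loopless
      (min-degree sym-H loopless tight (boundedTuples-up {1} {W = H} sym-H loopless r<s s≤n bounded)) (n<1+n r)
      (subst (λ x → r * x + (x + 2) ≤ suc n) (sym s≡) large)
      (subst (λ x → BoundedTuples 1 x H) (sym s≡) bounded))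

  -- The pairs of multiplicity a + 1 in a member of the family form an r-partite graph, so Turán's
  -- theorem bounds `q` by a C(s,2) + t_r(s).
  InF⇒boundedTuples : ∀ {a n s q} → r < s → (∃ λ v → InT r 0 a s v × edges v ≡ q) → ∀ {w} → InF n s q w →
                      BoundedTuples (suc a) s (symmetrise w)
  InF⇒boundedTuples {a} {n} {s} r<s (v , t@(f , _) , refl) {w} inF c c-inj =
    ≤-trans (+-monoˡ-≤ (suc a * s) (+-monoˡ-≤ (2 * missing s) total≤))
      (offset-bounded⁺ {a} {W = symmetrise v} {cross f} (InT-offset {w = v} t)
        (turán r<s (cross-symm f) (cross-loopless f) (cross-simple f) (cross-cliqueFree f)))
    where
    total≤ : total (symmetrise w on c) ≤ total (symmetrise v)
    total≤ = subst₂ _≤_ (2*edgesIn≡total {c = c} {image c} (image-enumerates c-inj) w) (2*edges≡total v)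
      (*-monoʳ-≤ 2 (inF (image c) (∣image∣ c-inj)))

  near⇒InT : ∀ {a n s} {w : Multigraph (suc n)} → r < s → s ≤ n → r * s + (s + 2) ≤ suc n →
    (∀ {i j} → i F.< j → Near a (w i j)) → BoundedTuples (suc a) s (symmetrise w) →
    suc a * suc n * suc n ≤ total (symmetrise w) + 2 * missing (suc n) + suc a * suc n → InT r 0 a (suc n) w
  near⇒InT {a} {n} {s} {w} r<s s≤n large near tuples tight =
    from-partition (tight⇒partition {H = H} sym-H loopless simple r<s s≤n large
      (λ c c-inj → offset-bounded⁻ {a} {W = W on c} {H on c} (offset-on {a} {W = W} {H} c-inj offset) (tuples c c-inj))
      (offset-tight⁻ {a} {W = W} {H} offset tight))
    where
    W H : Multigraph (suc n)
    W = symmetrise w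
    -- Truncated subtraction leaves the diagonal at 0, where `W` is 0 as well.
    H i j = W i j ∸ a
    near-W : ∀ {i j} → i F.< j → Near a (W i j)
    near-W i<j = subst (Near a) (sym (symmetrise-< w i<j)) (near i<j)
    sym-H : Symm H
    sym-H i j = cong (_∸ a) (symmetrise-symm w i j)
    loopless : Loopless H
    loopless i = trans (cong (_∸ a) (symmetrise-loopless w i)) (0∸n≡0 a)
    near-≥ : ∀ {x} → Near a x → x ≡ a + (x ∸ a)
    near-≥ (inj₁ refl) = sym (m+[n∸m]≡n ≤-refl)
    near-≥ (inj₂ refl) = sym (m+[n∸m]≡n (n≤1+n a))
    near-≤1 : ∀ {x} → Near a x → x ∸ a ≤ 1
    near-≤1 (inj₁ refl) = ≤-trans (≤-reflexive (n∸n≡0 a)) z≤n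
    near-≤1 (inj₂ refl) = ≤-reflexive (m+n∸n≡m 1 a)
    simple : Simple H
    simple i j with F.<-cmp i j
    ... | tri< i<j _ _  = near-≤1 (near-W i<j)
    ... | tri≈ _ refl _ = ≤-trans (≤-reflexive (loopless i)) z≤n
    ... | tri> _ _ j<i  = ≤-trans (≤-reflexive (sym-H i j)) (near-≤1 (near-W j<i))
    offset : Offset a W H
    offset = offset-offDiagonal {a} {W = W} {H} (symmetrise-symm w) sym-H (symmetrise-loopless w) loopless
      (λ i<j → near-≥ (near-W i<j))
    from-partition : (Σ (Fin (suc n) → Fin r) λ f → ∀ i j → (f i ≡ f j → H i j ≡ 0) × (H i j ≡ 0 → f i ≡ f j)) →
                     InT r 0 a (suc n) w
    from-partition (f , nonadjacent) = f , λ i j i<j → by-cases i<j (near i<j)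
      where
      by-cases : ∀ {i j} → i F.< j → Near a (w i j) → w i j ≡ partMult 0 a (f i) (f j)
      by-cases {i} {j} i<j (inj₁ w≡a) = trans w≡a (sym (partMult-≡ a (proj₂ (nonadjacent i j)
        (trans (cong (_∸ a) (trans (symmetrise-< w i<j) w≡a)) (n∸n≡0 a)))))
      by-cases {i} {j} i<j (inj₂ w≡1+a) = trans w≡1+a (sym (partMult-≢ a (λ e → 1+n≢0 (trans (sym (m+n∸n≡m 1 a))
        (trans (cong (_∸ a) (sym (trans (symmetrise-< w i<j) w≡1+a))) (proj₁ (nonadjacent i j) e))))))

  bounded⇒edges≤ : ∀ {a n} {w v : Multigraph n} → Bounded (suc a) (symmetrise w) →
    suc a * n * n ≤ total (symmetrise v) + 2 * missing n + suc a * n → edges w ≤ edges v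
  bounded⇒edges≤ {a} {n} {w} {v} bounded tight =
    *-cancelˡ-≤ 2 (subst₂ _≤_ (sym (2*edges≡total w)) (sym (2*edges≡total v))
      (+-cancelʳ-≤ (2 * missing n) _ _ (+-cancelʳ-≤ (suc a * n) _ _ (≤-trans bounded tight))))

  extremal : ∀ {a n s} → 1 ≤ a → r < s → s ≤ n → r * s + (s + 2) ≤ suc n →
    ∀ {w v} → BoundedTuples (suc a) s (symmetrise w) → InT r 0 a (suc n) v →
    suc a * suc n * suc n ≤ total (symmetrise v) + 2 * missing (suc n) + suc a * suc n →
    prodW w < prodW v ⊎ (prodW w ≡ prodW v × InT r 0 a (suc n) w)
  extremal {a} {n} {s} 1≤a r<s s≤n large {w} {v} tuples v∈T tight =
    conclude (AMGM.integral-AMGM a {{>-nonZero 1≤a}} (weights w) (weights v) (weights-length w v)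
      (weights-All⁺ {w = v} (InT-near {w = v} v∈T)) (bounded⇒edges≤ {a} {w = w} {v} bounded tight))
    where
    bounded : Bounded (suc a) (symmetrise w)
    bounded = boundedTuples-up {suc a} {W = symmetrise w} (symmetrise-symm w) (symmetrise-loopless w) r<s
      (m≤n⇒m≤1+n s≤n) tuples id id
    tight-w : edges w ≡ edges v → suc a * suc n * suc n ≤ total (symmetrise w) + 2 * missing (suc n) + suc a * suc n
    tight-w edges≡ = subst (λ t → suc a * suc n * suc n ≤ t + 2 * missing (suc n) + suc a * suc n)
      (trans (sym (2*edges≡total v)) (trans (cong (2 *_) (sym edges≡)) (2*edges≡total w))) tight
    conclude : prodW w < prodW v ⊎ (prodW w ≡ prodW v × All (Near a) (weights w) × edges w ≡ edges v) →
               prodW w < prodW v ⊎ (prodW w ≡ prodW v × InT r 0 a (suc n) w)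
    conclude (inj₁ lt) = inj₁ lt
    conclude (inj₂ (eq , near , edges≡)) =
      inj₂ (eq , near⇒InT {w = w} r<s s≤n large (weights-All⁻ {w = w} near) tuples (tight-w edges≡))

  -- The comparison is with a member of the family, so the maximality of `p` there yields both the
  -- upper bound and the equality case.
  extremal-InF : ∀ {a n s q} → 1 ≤ a → r < s → s ≤ n → r * s + (s + 2) ≤ suc n →
    (∃ λ v → InT r 0 a s v × edges v ≡ q) → ∀ {w} → InF (suc n) s q w →
    ∃ λ v → InT r 0 a (suc n) v × (prodW w < prodW v ⊎ (prodW w ≡ prodW v × InT r 0 a (suc n) w))
  extremal-InF {a} {n} 1≤a r<s s≤n large attained {w} inF = compare (turánPartition (suc n))
    where
    compare : (Σ (Fin (suc n) → Fin r) λ f → Tight (cross f)) →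
              ∃ λ v → InT r 0 a (suc n) v × (prodW w < prodW v ⊎ (prodW w ≡ prodW v × InT r 0 a (suc n) w))
    compare (f , tight) = v , v∈T ,
      extremal 1≤a r<s s≤n large {w} {v} (InF⇒boundedTuples {a} r<s attained {w} inF) v∈T
        (offset-tight⁺ {a} {W = symmetrise v} {cross f} (InT-offset {w = v} v∈T) tight)
      where
      v = partGraph a f
      v∈T = partGraph-InT a f

theorem3p10 : (a r s n : ℕ) → 1 ≤ a → 1 ≤ r → r + 1 ≤ s →
    2 * (r * (s + 2)) ≤ n →
    (r * (s + 2)) * (r * (s + 2)) * (s ∸ 1)
    ≤ (n ∸ 2 * (r * (s + 2))) * (n ∸ 2 * (r * (s + 2))) →
    (q : ℕ) → IsMax (InT r 0 a s) edges q →
    (p : ℕ) → IsMax (InT r 0 a n) prodW p →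
    IsMax (InF n s q) prodW p ×
    ((w : Multigraph n) →
    ((InF n s q w × prodW w ≡ p) → (InT r 0 a n w × prodW w ≡ p)) ×
    ((InT r 0 a n w × prodW w ≡ p) → (InF n s q w × prodW w ≡ p)))
-- Splitting `s` makes the left side of the first lower bound on `n` reduce to a successor, which
-- refutes n = 0.
theorem3p10 a (suc r′) zero    zero _ _ ()
theorem3p10 a (suc r′) (suc s) zero _ _ _ ()
theorem3p10 a r@(suc r′) s (suc n) 1≤a _ r+1≤s large _ q (attained , q-max) p ((v , v∈T , v≡p) , p-max) =
  ((v , InT⇒InF {v} v∈T , v≡p) , λ w inF → upper-bound {w} (compare w inF)) ,
  λ w → (λ (inF , w≡p) → uniqueness {w} (compare w inF) w≡p , w≡p) , (λ (t , w≡p) → InT⇒InF {w} t , w≡p)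
  where
  open Turán r
  r<s : r < s
  r<s = subst (_≤ s) (+-comm r 1) r+1≤s
  -- The descent from s-sets asks for r s + s + 2 ≤ n, the case m = s of n ≥ r m + m + 2.
  slack : ∀ r′ s → 2 * (suc r′ * (s + 2)) ≡ suc r′ * s + (s + 2) + (2 + (4 * r′ + r′ * s))
  slack = solve-∀
  large′ : r * s + (s + 2) ≤ suc n
  large′ = ≤-trans (≤-trans (m≤m+n _ _) (≤-reflexive (sym (slack r′ s)))) large
  s≤n : s ≤ n
  s≤n = s≤s⁻¹ (≤-trans (≤-trans (≤-reflexive (+-comm 1 s)) (+-monoʳ-≤ s (s≤s z≤n)))
    (≤-trans (m≤n+m (s + 2) (r * s)) large′))
  InT⇒InF : ∀ {w} → InT r 0 a (suc n) w → InF (suc n) s q w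
  InT⇒InF {w} t X ∣X∣≡s = InT-edgesIn {w = w} t X
    (subst (λ s → ∀ v → InT r 0 a s v → edges v ≤ q) (sym ∣X∣≡s) q-max)
  Comparison : Multigraph (suc n) → Set
  Comparison w = ∃ λ v → InT r 0 a (suc n) v × (prodW w < prodW v ⊎ (prodW w ≡ prodW v × InT r 0 a (suc n) w))
  compare : ∀ w → InF (suc n) s q w → Comparison w
  compare w inF = extremal-InF 1≤a r<s s≤n large′ attained {w} inF
  upper-bound : ∀ {w} → Comparison w → prodW w ≤ p
  upper-bound (v , t , inj₁ lt)       = <⇒≤ (<-≤-trans lt (p-max v t))
  upper-bound (v , t , inj₂ (eq , _)) = ≤-trans (≤-reflexive eq) (p-max v t)
  uniqueness : ∀ {w} → Comparison w → prodW w ≡ p → InT r 0 a (suc n) w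
  uniqueness (v , t , inj₁ lt)      w≡p = contradiction w≡p (<⇒≢ (<-≤-trans lt (p-max v t)))
  uniqueness (_ , _ , inj₂ (_ , t)) w≡p = t
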